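{- Let $G$ be a $3$-connected trivalent graph with $2g-2$ vertices, $C_G\subset\mathbb{P}^{g-1}$ its graph curve, and $M_G$ the matroid of the configuration $X_G=H\cap C_G$ for a generic hyperplane $H$. Then $M_G$ is self-dual, and $M_G$ depends only on the graph $G$ (not on the choice of the generic hyperplane or of the realization of $C_G$).
   Context: Let $G$ be a $3$-connected trivalent graph with $2g-2$ vertices and $3g-3$ edges. Orient its edges and let $\mathrm{Cyc}_G$ be a $g\times(3g-3)$ matrix whose rows span the cycle space of $G$; its columns give points in $\mathbb{P}^{g-1}$ indexed by edges. For each vertex $v$, the three columns indexed by edges at $v$ span a line $L_v$, and the graph curve $C_G$ is the union of these $2g-2$ lines (the stable canonical curve with dual graph $G$). For a generic hyperplane $H\cong\mathbb{P}^{g-2}$, $X_G$ consists of the $2g-2$ distinct points $p_v=L_v\cap H$, and $M_G$ is the rank $g-1$ matroid on the vertices of $G$ given by linear dependence among the $p_v$. A matroid of rank $n$ on $2n$ elements is self-dual if an $n$-set is a basis exactly when its complement is a basis. -}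

module Defs where

open import Level using (0ℓ)
open import Algebra.Bundles using (CommutativeRing)
open import Data.Nat as ℕ using (ℕ; zero; suc; _∸_; _≤_)
open import Data.Fin using (Fin; _≟_)
open import Data.Fin.Subset using (Subset; _∈_; _∉_; ∣_∣; ∁)
open import Data.Vec using (lookup)
open import Data.Bool using (Bool; true; false; if_then_else_)
open import Data.List using (List; []; _∷_; _∷ʳ_)
open import Data.Product using (Σ; ∃; _×_; _,_; proj₁; proj₂)
open import Data.Sum using (_⊎_)
open import Relation.Nullary using (¬_; does)
open import Relation.Binary.PropositionalEquality using (_≡_)
open import Function.Bundles using (_⇔_)

module RingFns (R : CommutativeRing 0ℓ 0ℓ) where
  open CommutativeRing R
  evalU : List Carrier → Carrier → Carrier
  evalU [] x = 0#
  evalU (c ∷ cs) x = c + x * evalU cs x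
  natK : ℕ → Carrier
  natK zero = 0#
  natK (suc n) = 1# + natK n

record ACField : Set₁ where
  field
    cring : CommutativeRing 0ℓ 0ℓ
  open CommutativeRing cring public
  open RingFns cring public
  field
    1≉0        : ¬ (1# ≈ 0#)
    inverse    : ∀ x → ¬ (x ≈ 0#) → ∃ λ y → x * y ≈ 1#
    char0      : ∀ n → ¬ (natK (suc n) ≈ 0#)
    algClosed  : ∀ (c : Carrier) (cs : List Carrier) →
                 ∃ λ x → evalU ((c ∷ cs) ∷ʳ 1#) x ≈ 0#

record Graph (n e : ℕ) : Set where
  field
    ends : Fin e → Fin n × Fin n

module _ {n e : ℕ} (G : Graph n e) where
  open Graph G

  ind : ∀ {m} → Fin m → Fin m → ℕ
  ind a b = if does (a ≟ b) then 1 else 0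

  countFin : ∀ {m} → (Fin m → ℕ) → ℕ
  countFin {zero}  f = 0
  countFin {suc m} f = f Fin.zero ℕ.+ countFin {m} (λ i → f (Fin.suc i))

  -- number of edge-ends at v (a loop counts twice)
  degree : Fin n → ℕ
  degree v = countFin (λ x → ind (proj₁ (ends x)) v ℕ.+ ind (proj₂ (ends x)) v)

  Trivalent : Set
  Trivalent = ∀ v → degree v ≡ 3

  Simple : Set
  Simple = (∀ x → ¬ (proj₁ (ends x) ≡ proj₂ (ends x)))
         × (∀ x y → ¬ (x ≡ y) →
              ¬ ((proj₁ (ends x) ≡ proj₁ (ends y) × proj₂ (ends x) ≡ proj₂ (ends y))
               ⊎ (proj₁ (ends x) ≡ proj₂ (ends y) × proj₂ (ends x) ≡ proj₁ (ends y))))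

  data Walk (S : Subset n) : Fin n → Fin n → Set where
    here  : ∀ {u} → Walk S u u
    fwd   : ∀ {u w} (x : Fin e) → proj₁ (ends x) ≡ u → proj₂ (ends x) ∉ S →
            Walk S (proj₂ (ends x)) w → Walk S u w
    bwd   : ∀ {u w} (x : Fin e) → proj₂ (ends x) ≡ u → proj₁ (ends x) ∉ S →
            Walk S (proj₁ (ends x)) w → Walk S u w

  ThreeConnected : Set
  ThreeConnected = Simple × (4 ≤ n) ×
    (∀ (S : Subset n) → ∣ S ∣ ≤ 2 → ∀ u w → u ∉ S → w ∉ S → Walk S u w)

module Lin (K : ACField) where
  open ACField K

  ∑ : ∀ {m} → (Fin m → Carrier) → Carrier
  ∑ {zero}  f = 0#
  ∑ {suc m} f = f Fin.zero + ∑ {m} (λ i → f (Fin.suc i))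

  data Poly (m : ℕ) : Set where
    con  : Carrier → Poly m
    var  : Fin m → Poly m
    _⊕_  : Poly m → Poly m → Poly m
    _⊛_  : Poly m → Poly m → Poly m

  evalP : ∀ {m} → Poly m → (Fin m → Carrier) → Carrier
  evalP (con c) x = c
  evalP (var i) x = x i
  evalP (p ⊕ q) x = evalP p x + evalP q x
  evalP (p ⊛ q) x = evalP p x * evalP q x

  indK : ∀ {m} → Fin m → Fin m → Carrier
  indK a b = if does (a ≟ b) then 1# else 0#

  module _ {n e : ℕ} (G : Graph n e) where
    open Graph G

    Orientation : Set
    Orientation = Fin e → Bool

    src tgt : Orientation → Fin e → Fin n
    src o x = if o x then proj₁ (ends x) else proj₂ (ends x)
    tgt o x = if o x then proj₂ (ends x) else proj₁ (ends x)

    inc : Orientation → Fin n → Fin e → Carrier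
    inc o v x = indK (tgt o x) v - indK (src o x) v

    InCycleSpace : Orientation → (Fin e → Carrier) → Set
    InCycleSpace o z = ∀ v → ∑ (λ x → inc o v x * z x) ≈ 0#

    CycMatrix : (g : ℕ) → Orientation → (Fin g → Fin e → Carrier) → Set
    CycMatrix g o Cyc =
        (∀ i → InCycleSpace o (Cyc i))
      × (∀ (c : Fin g → Carrier) → (∀ x → ∑ (λ i → c i * Cyc i x) ≈ 0#) → ∀ i → c i ≈ 0#)
      × (∀ z → InCycleSpace o z → ∃ λ (c : Fin g → Carrier) → ∀ x → z x ≈ ∑ (λ i → c i * Cyc i x))

    Incident : Fin n → Fin e → Set
    Incident v x = proj₁ (ends x) ≡ v ⊎ proj₂ (ends x) ≡ v

    module _ {g : ℕ} (Cyc : Fin g → Fin e → Carrier) (h : Fin g → Carrier) where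
      -- w ∈ K^g lies in the span of the columns indexed by edges at v (the line L_v)
      OnLine : Fin n → (Fin g → Carrier) → Set
      OnLine v w = ∃ λ (a : Fin e → Carrier) → (∀ x → ¬ Incident v x → a x ≈ 0#)
                   × (∀ i → w i ≈ ∑ (λ x → a x * Cyc i x))

      -- w is a (nonzero) representative of the point p_v = L_v ∩ H, H = {h = 0}
      RepOf : Fin n → (Fin g → Carrier) → Set
      RepOf v w = OnLine v w × (∃ λ i → ¬ (w i ≈ 0#)) × (∑ (λ i → h i * w i) ≈ 0#)

      -- S independent in M_G (w.r.t. H): the points p_v, v ∈ S, are linearly independent
      Indep : Subset n → Set
      Indep S = ∀ (w : Fin n → Fin g → Carrier) → (∀ v → v ∈ S → RepOf v (w v)) →
                ∀ (c : Fin n → Carrier) →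
                (∀ i → ∑ (λ v → (if lookup S v then c v else 0#) * w v i) ≈ 0#) →
                ∀ v → v ∈ S → c v ≈ 0#

module _ {n : ℕ} (I : Subset n → Bool) where
  IsBasis : ℕ → Subset n → Set
  IsBasis r B = I B ≡ true × ∣ B ∣ ≡ r

  -- rank r matroid on 2r elements is self-dual
  SelfDual : ℕ → Set
  SelfDual r = (∃ λ B → IsBasis r B)
             × (∀ S → I S ≡ true → ∣ S ∣ ≤ r)
             × (∀ B → ∣ B ∣ ≡ r → (IsBasis r B ⇔ IsBasis r (∁ B)))

{-# OPTIONS --safe #-}
module Submission where

-- A hyperplane H corresponds to a flow t on G, and the point p_v to the linear form
-- s ↦ t₂ s₁ - t₁ s₂ on flows, where 1, 2, 3 are the edges at v, all oriented towards v.
-- The flows are spanned by integer flows read off from paths in G, so the coordinates of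
-- the p_v are polynomials with integer coefficients in a parameter τ of t.
-- Elimination over these polynomials yields, for every S, either a polynomial relation among
-- the p_v or a right inverse up to a denominator; this is the matroid M, and where none of the
-- finitely many pivots and denominators vanishes, independence over K agrees with M.
--
-- For self-duality, let W be the space of all vectors (p_v(s))_v with s a flow.  With
-- λ_v = 1 / (t₁ t₂ t₃) one has λ_v p_v(s) p_v(s′) = - Σ_{x ∋ v} s_x s′_x / t_x, and the terms at
-- the two ends of an edge cancel, so W is isotropic for the diagonal form λ.  Conversely, a vector
-- orthogonal to W comes from local flows at the vertices, which can be corrected by multiples
-- of t to agree along the edges; hence W is its own orthogonal complement.  So S is dependent
-- exactly when W contains a nonzero vector supported on S, and a dimension count gives duality.
--
-- Equality in K is neither decidable nor stable, so independence is always derived from an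
-- invertible denominator, and case distinctions on K are made only towards a contradiction.

open import Defs
open import Level using (0ℓ)
open import Algebra.Bundles using (CommutativeRing)
open import Algebra.Solver.Ring.AlmostCommutativeRing using (_-Raw-AlmostCommutative⟶_; fromCommutativeRing)
import Algebra.Properties.Ring as RingProperties
import Algebra.Properties.Semiring.Mult as Mult
import Algebra.Properties.Semiring.Sum as SemiringSum
import Algebra.Solver.Ring as RingSolver
open import Data.Bool using (Bool; true; false; if_then_else_)
import Data.Bool.Properties as Boolₚ
open import Data.Empty using (⊥; ⊥-elim)
open import Data.Fin using (Fin; zero; suc; _≟_; fromℕ<)
open import Data.Fin.Properties using (suc-injective; any?)
open import Data.Fin.Subset using (Subset; _∈_; _∉_; ∣_∣; ⁅_⁆; ∁; _∪_; inside; outside) renaming (⊥ to ∅)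
open import Data.Fin.Subset.Properties
open import Data.Integer as ℤ using (ℤ; +_; -[1+_]; _⊖_)
import Data.Integer.Properties as ℤₚ
open import Data.List using (List; []; _∷_; map; length)
open import Data.List.Properties using (length-map)
open import Data.List.Relation.Unary.All as All using (All; []; _∷_)
import Data.List.Relation.Unary.All.Properties as Allₚ
open import Data.List.Relation.Unary.AllPairs using ([]; _∷_)
open import Data.List.Relation.Unary.Unique.Propositional using (Unique)
import Data.List.Relation.Unary.Unique.Propositional.Properties as Uniqueₚ
open import Data.Maybe using (Maybe; just; nothing)
open import Data.Nat as ℕ using (ℕ; zero; suc; _≤_; _<_; z≤n; s≤s; _∸_)
import Data.Nat.Properties as ℕₚ
open import Data.Product using (∃; _×_; _,_; proj₁; proj₂)
open import Data.Sum using (_⊎_; inj₁; inj₂; [_,_]′)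
open import Data.Vec using ([]; _∷_; here; there; lookup; _[_]≔_)
import Data.Vec.Functional as V
open import Data.Vec.Properties using (lookup⇒[]=; []=⇒lookup)
open import Function using (_∘_)
open import Function.Bundles using (_⇔_; mk⇔)
open import Relation.Nullary using (¬_; Dec; yes; no; does; contradiction; ¬?; _×-dec_)
open import Relation.Nullary.Decidable using (¬¬-excluded-middle)
open import Relation.Binary.PropositionalEquality as ≡ using (_≡_; _≢_)

-- The matroid must be a Boolean function although `K` has no zero test. What can be tested is an
-- integer polynomial: in Horner form, a nonzero one is nonzero at all natural points whose
-- coordinates are chosen large enough one after the other, and characteristic 0 carries this to
-- `K`. Hence flows, points and elimination are kept integral and free of division. The weights λ_v
-- are forced. The values of flows at v form the plane s₁ + s₂ + s₃ = 0. On it the form Σ sᵢ s′ᵢ /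
-- tᵢ has t in its radical, because Σ tᵢ s′ᵢ / tᵢ = Σ s′ᵢ = 0; so it is a multiple of the square of
-- the linear form that kills t, which is p_v. No dimension of the flow space is computed. The rank
-- comes from two inequalities: isotropy bounds an independent set by the size of its complement,
-- and the complement of a maximal independent set is independent again. The forms p_v do not
-- mention `Cyc`: a cycle matrix only chooses coordinates on the flows, and `M` is fixed before any
-- realization is given.

-- Integer constants in a commutative ring, and a ring solver over them.

module Integers (R : CommutativeRing 0ℓ 0ℓ) where
  open CommutativeRing R hiding (zero)
  open RingProperties ring using (-‿+-comm; -‿involutive; -0#≈0#; -‿distribˡ-*; -‿distribʳ-*)
  open Mult semiring using (×-homo-+; ×1-homo-*) renaming (_×_ to _·_)
  open import Relation.Binary.Reasoning.Setoid setoid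

  ι : ℤ → Carrier
  ι (+ n)    = n · 1#
  ι -[1+ n ] = - (suc n · 1#)

  ι-neg : ∀ i → ι (ℤ.- i) ≈ - ι i
  ι-neg (+ zero)  = sym -0#≈0#
  ι-neg (+ suc n) = refl
  ι-neg -[1+ n ]  = sym (-‿involutive _)

  cancel-1 : ∀ a b → a - b ≈ (1# + a) - (1# + b)
  cancel-1 a b = begin
    a - b                      ≈⟨ +-congʳ (sym (+-identityˡ a)) ⟩
    (0# + a) - b               ≈⟨ +-congʳ (+-congʳ (sym (-‿inverseʳ 1#))) ⟩
    ((1# - 1#) + a) - b        ≈⟨ +-congʳ (+-assoc _ _ _) ⟩
    (1# + (- 1# + a)) - b      ≈⟨ +-congʳ (+-congˡ (+-comm _ _)) ⟩
    (1# + (a - 1#)) - b        ≈⟨ +-congʳ (sym (+-assoc _ _ _)) ⟩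
    ((1# + a) - 1#) - b        ≈⟨ +-assoc _ _ _ ⟩
    (1# + a) + (- 1# - b)      ≈⟨ +-congˡ (-‿+-comm 1# b) ⟩
    (1# + a) - (1# + b)        ∎

  ι-⊖ : ∀ m n → ι (m ⊖ n) ≈ m · 1# - n · 1#
  ι-⊖ m zero rewrite ℤₚ.⊖-≥ {m} {0} ℕ.z≤n = sym (trans (+-congˡ -0#≈0#) (+-identityʳ _))
  ι-⊖ zero (suc n) = sym (+-identityˡ _)
  ι-⊖ (suc m) (suc n) rewrite ℤₚ.[1+m]⊖[1+n]≡m⊖n m n =
    trans (ι-⊖ m n) (cancel-1 _ _)

  ι-+ : ∀ i j → ι (i ℤ.+ j) ≈ ι i + ι j
  ι-+ (+ m)    (+ n)    = ×-homo-+ 1# m n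
  ι-+ (+ m)    -[1+ n ] = ι-⊖ m (suc n)
  ι-+ -[1+ m ] (+ n)    = trans (ι-⊖ n (suc m)) (+-comm _ _)
  ι-+ -[1+ m ] -[1+ n ] = begin
    - (suc (suc (m ℕ.+ n)) · 1#)       ≡⟨ ≡.cong (λ k → - (suc k · 1#)) (≡.sym (ℕₚ.+-suc m n)) ⟩
    - ((suc m ℕ.+ suc n) · 1#)         ≈⟨ -‿cong (×-homo-+ 1# (suc m) (suc n)) ⟩
    - (suc m · 1# + suc n · 1#)        ≈⟨ sym (-‿+-comm _ _) ⟩
    - (suc m · 1#) - (suc n · 1#)      ∎

  ι-*⁺ : ∀ m j → ι (+ m ℤ.* j) ≈ ι (+ m) * ι j
  ι-*⁺ m (+ n) rewrite ≡.sym (ℤₚ.pos-* m n) = ×1-homo-* m n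
  ι-*⁺ m -[1+ n ] = begin
    ι (+ m ℤ.* ℤ.- (+ suc n))      ≡⟨ ≡.cong ι (≡.sym (ℤₚ.neg-distribʳ-* (+ m) (+ suc n))) ⟩
    ι (ℤ.- (+ m ℤ.* + suc n))      ≡⟨ ≡.cong (λ k → ι (ℤ.- k)) (≡.sym (ℤₚ.pos-* m (suc n))) ⟩
    ι (ℤ.- (+ (m ℕ.* suc n)))      ≈⟨ ι-neg (+ (m ℕ.* suc n)) ⟩
    - ((m ℕ.* suc n) · 1#)         ≈⟨ -‿cong (×1-homo-* m (suc n)) ⟩
    - (m · 1# * (suc n · 1#))      ≈⟨ -‿distribʳ-* _ _ ⟩
    m · 1# * - (suc n · 1#)        ∎

  ι-* : ∀ i j → ι (i ℤ.* j) ≈ ι i * ι j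
  ι-* (+ m)    j = ι-*⁺ m j
  ι-* -[1+ m ] j = begin
    ι (ℤ.- (+ suc m) ℤ.* j)   ≡⟨ ≡.cong ι (≡.sym (ℤₚ.neg-distribˡ-* (+ suc m) j)) ⟩
    ι (ℤ.- (+ suc m ℤ.* j))   ≈⟨ ι-neg (+ suc m ℤ.* j) ⟩
    - ι (+ suc m ℤ.* j)       ≈⟨ -‿cong (ι-*⁺ (suc m) j) ⟩
    - (ι (+ suc m) * ι j)     ≈⟨ -‿distribˡ-* _ _ ⟩
    - ι (+ suc m) * ι j       ∎

  ι-1 : ι (+ 1) ≈ 1#
  ι-1 = +-identityʳ 1#

  private
    morphism : ℤ.+-*-rawRing -Raw-AlmostCommutative⟶ fromCommutativeRing R
    morphism = record
      { ⟦_⟧ = ι ; +-homo = ι-+ ; *-homo = ι-* ; -‿homo = ι-neg ; 0-homo = refl ; 1-homo = ι-1 }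

    dec : ∀ i j → Maybe (ι i ≈ ι j)
    dec i j with i ℤₚ.≟ j
    ... | yes ≡.refl = just refl
    ... | no _       = nothing

  -- Coefficients are compared in ℤ, so normalisation works without a zero test in the ring. As
  -- `ι (+ 1)` unfolds to `1# + 0#`, goals that mention `1#` pass it to the solver as a variable.
  module Solver = RingSolver ℤ.+-*-rawRing (fromCommutativeRing R) morphism dec

-- Finite sums and Kronecker deltas.

module Sums (R : CommutativeRing 0ℓ 0ℓ) where
  open CommutativeRing R hiding (zero)
  open RingProperties ring using (-1*x≈-x)
  open SemiringSum semiring public using (sum; sum-cong-≋; sum-replicate-zero)
    renaming (∑-distrib-+ to sum-+; ∑-comm to sum-swap; *-distribˡ-sum to *-sum; *-distribʳ-sum to sum-*)
  open import Relation.Binary.Reasoning.Setoid setoid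

  sum-zero : ∀ {m} {f : Fin m → Carrier} → (∀ i → f i ≈ 0#) → sum f ≈ 0#
  sum-zero {m} f≈0 = trans (sum-cong-≋ f≈0) (sum-replicate-zero m)

  sum-neg : ∀ {m} (f : Fin m → Carrier) → sum (λ i → - f i) ≈ - sum f
  sum-neg f = begin
    sum (λ i → - f i)         ≈⟨ sum-cong-≋ (λ i → sym (-1*x≈-x (f i))) ⟩
    sum (λ i → - 1# * f i)    ≈⟨ sym (*-sum (- 1#) f) ⟩
    - 1# * sum f              ≈⟨ -1*x≈-x _ ⟩
    - sum f                   ∎

  sum-sub : ∀ {m} (f g : Fin m → Carrier) → sum (λ i → f i - g i) ≈ sum f - sum g
  sum-sub f g = trans (sum-+ f (λ i → - g i)) (+-congˡ (sum-neg g))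

  -- The body is that of `indK`, so incidence numbers of a realization unfold to expressions in `δ`.
  δ : ∀ {m} → Fin m → Fin m → Carrier
  δ a b = if does (a ≟ b) then 1# else 0#

  δ-refl : ∀ {m} (a : Fin m) → δ a a ≈ 1#
  δ-refl a with a ≟ a
  ... | yes _ = refl
  ... | no a≢a = contradiction ≡.refl a≢a

  δ-≢ : ∀ {m} {a b : Fin m} → a ≢ b → δ a b ≈ 0#
  δ-≢ {a = a} {b} a≢b with a ≟ b
  ... | yes a≡b = contradiction a≡b a≢b
  ... | no _ = refl

  δ-sym : ∀ {m} (a b : Fin m) → δ a b ≈ δ b a
  δ-sym a b with a ≟ b
  ... | yes ≡.refl = sym (δ-refl a)
  ... | no a≢b = sym (δ-≢ (λ b≡a → a≢b (≡.sym b≡a)))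

  δ-suc : ∀ {m} (a b : Fin m) → δ (suc a) (suc b) ≈ δ a b
  δ-suc a b with a ≟ b
  ... | yes _ = refl
  ... | no _ = refl

  sum-single : ∀ {m} (a : Fin m) (f : Fin m → Carrier) → (∀ i → i ≢ a → f i ≈ 0#) → sum f ≈ f a
  sum-single zero f f≈0 = trans (+-congˡ (sum-zero (λ i → f≈0 (suc i) λ ()))) (+-identityʳ _)
  sum-single (suc a) f f≈0 =
    trans (+-cong (f≈0 zero λ ())
                  (sum-single a (λ i → f (suc i)) (λ i i≢a → f≈0 (suc i) (λ e → i≢a (suc-injective e)))))
          (+-identityˡ _)

  sum-δ : ∀ {m} (a : Fin m) (f : Fin m → Carrier) → sum (λ i → δ a i * f i) ≈ f a
  sum-δ a f = trans
    (sum-single a _ (λ i i≢a → trans (*-congʳ (δ-≢ (λ e → i≢a (≡.sym e)))) (zeroˡ _)))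
    (trans (*-congʳ (δ-refl a)) (*-identityˡ _))

-- Division-free elimination.

zero-or-exists : ∀ {m} {A B : Fin m → Set} → (∀ j → A j ⊎ B j) → (∀ j → A j) ⊎ ∃ B
zero-or-exists {zero} d = inj₁ λ ()
zero-or-exists {suc m} d with d zero | zero-or-exists (λ j → d (suc j))
... | inj₂ b | _ = inj₂ (zero , b)
... | inj₁ a | inj₂ (j , b) = inj₂ (suc j , b)
... | inj₁ a | inj₁ as = inj₁ λ { zero → a ; (suc j) → as j }

-- `NZ` is a strong form of being nonzero. For polynomials it will mean nonzero at all eventually
-- large natural points, which is what specialization needs.
module Elimination
  (R : CommutativeRing 0ℓ 0ℓ)
  (NZ : CommutativeRing.Carrier R → Set)
  (zero-or-NZ : ∀ x → CommutativeRing._≈_ R x (CommutativeRing.0# R) ⊎ NZ x)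
  (NZ-1 : NZ (CommutativeRing.1# R))
  (NZ-* : ∀ x y → NZ x → NZ y → NZ (CommutativeRing._*_ R x y))
  where
  open CommutativeRing R hiding (zero)
  open Sums R
  open Integers R using (module Solver)
  open Solver using (solve; _:=_; _:*_; _:-_; :-_; con)
  open import Relation.Binary.Reasoning.Setoid setoid

  record Dependency {n m} (S : Subset n) (Q : Fin n → Fin m → Carrier) : Set where
    field
      coeff    : Fin n → Carrier
      support  : ∀ v → v ∉ S → coeff v ≈ 0#
      pivot    : Fin n
      pivot-NZ : NZ (coeff pivot)
      relation : ∀ j → sum (λ v → coeff v * Q v j) ≈ 0#

  -- A positive certificate of independence: pairing a relation among the rows in `S` with `inv v`
  -- isolates `denom` times its coefficient at `v`. It survives every specialization at which
  -- `denom` does not vanish.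
  record RightInverse {n m} (S : Subset n) (Q : Fin n → Fin m → Carrier) : Set where
    field
      denom    : Carrier
      denom-NZ : NZ denom
      inv      : Fin n → Fin m → Carrier
      support  : ∀ v → v ∉ S → ∀ j → inv v j ≈ 0#
      inverse  : ∀ u → u ∈ S → ∀ v → sum (λ j → Q u j * inv v j) ≈ denom * δ u v

  module Extend {n m} (S : Subset n) (Q : Fin (suc n) → Fin m → Carrier)
                (I : RightInverse S (λ v → Q (suc v))) where
    open RightInverse I renaming (denom to D; inv to L)

    q : Fin m → Carrier
    q = Q zero

    α : Fin n → Carrier
    α v = sum (λ j → q j * L v j)

    α-support : ∀ v → v ∉ S → α v ≈ 0#
    α-support v v∉S = sum-zero (λ j → trans (*-congˡ (support v v∉S j)) (zeroʳ _))

    -- `α / D` are the only coefficients with which `q` could be a combination of the rows in `S`;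
    -- scaling by `D` avoids the division.
    residue : Fin m → Carrier
    residue j = D * q j - sum (λ v → α v * Q (suc v) j)

    dependency : (∀ j → residue j ≈ 0#) → Dependency (inside ∷ S) Q
    dependency r≈0 = record
      { coeff = λ { zero → D ; (suc v) → - α v }
      ; support = λ { zero v∉ → contradiction here v∉
                    ; (suc v) v∉ → trans (-‿cong (α-support v (drop-not-there v∉))) -0≈0 }
      ; pivot = zero
      ; pivot-NZ = denom-NZ
      ; relation = λ j → trans (+-congˡ (trans (sum-cong-≋ (λ v → neg-* (α v) (Q (suc v) j)))
                                               (sum-neg (λ v → α v * Q (suc v) j))))
                               (r≈0 j)
      }
      where
      open RingProperties ring using () renaming (-0#≈0# to -0≈0)
      neg-* : ∀ x y → - x * y ≈ - (x * y)
      neg-* = solve 2 (λ x y → :- x :* y := :- (x :* y)) refl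

    module _ (j₀ : Fin m) (r≉0 : NZ (residue j₀)) where
      r : Carrier
      r = residue j₀

      -- `D` times the unit vector at `j₀`, corrected so that every row in `S` kills it; its pairing
      -- with `q` is then `r`.
      u : Fin m → Carrier
      u j = D * δ j₀ j - sum (λ v → Q (suc v) j₀ * L v j)

      sum-u : ∀ (a : Fin m → Carrier) →
              sum (λ j → a j * u j) ≈ D * a j₀ - sum (λ v → Q (suc v) j₀ * sum (λ j → a j * L v j))
      sum-u a = begin
        sum (λ j → a j * u j)
          ≈⟨ sum-cong-≋ (λ j → solve 4 (λ x d e s → x :* (d :* e :- s) := d :* (e :* x) :- x :* s) refl
                                 (a j) D (δ j₀ j) _) ⟩
        sum (λ j → D * (δ j₀ j * a j) - a j * sum (λ v → Q (suc v) j₀ * L v j))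
          ≈⟨ sum-sub (λ j → D * (δ j₀ j * a j)) _ ⟩
        sum (λ j → D * (δ j₀ j * a j)) - sum (λ j → a j * sum (λ v → Q (suc v) j₀ * L v j))
          ≈⟨ +-cong (trans (sym (*-sum D (λ j → δ j₀ j * a j))) (*-congˡ (sum-δ j₀ a))) (-‿cong swapped) ⟩
        D * a j₀ - sum (λ v → Q (suc v) j₀ * sum (λ j → a j * L v j)) ∎
        where
        swapped : sum (λ j → a j * sum (λ v → Q (suc v) j₀ * L v j))
                ≈ sum (λ v → Q (suc v) j₀ * sum (λ j → a j * L v j))
        swapped = begin
          sum (λ j → a j * sum (λ v → Q (suc v) j₀ * L v j))
            ≈⟨ sum-cong-≋ (λ j → *-sum (a j) (λ v → Q (suc v) j₀ * L v j)) ⟩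
          sum (λ j → sum (λ v → a j * (Q (suc v) j₀ * L v j)))
            ≈⟨ sum-swap (λ j v → a j * (Q (suc v) j₀ * L v j)) ⟩
          sum (λ v → sum (λ j → a j * (Q (suc v) j₀ * L v j)))
            ≈⟨ sum-cong-≋ (λ v → sum-cong-≋ (λ j →
                 solve 3 (λ x y z → x :* (y :* z) := y :* (x :* z)) refl (a j) (Q (suc v) j₀) (L v j))) ⟩
          sum (λ v → sum (λ j → Q (suc v) j₀ * (a j * L v j)))
            ≈⟨ sum-cong-≋ (λ v → sym (*-sum (Q (suc v) j₀) (λ j → a j * L v j))) ⟩
          sum (λ v → Q (suc v) j₀ * sum (λ j → a j * L v j)) ∎

      q·u : sum (λ j → q j * u j) ≈ r
      q·u = trans (sum-u q) (+-congˡ (-‿cong (sum-cong-≋ (λ v → *-comm (Q (suc v) j₀) (α v)))))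

      Q·u : ∀ w → w ∈ S → sum (λ j → Q (suc w) j * u j) ≈ 0#
      Q·u w w∈S = begin
        sum (λ j → Q (suc w) j * u j)
          ≈⟨ sum-u (Q (suc w)) ⟩
        D * Q (suc w) j₀ - sum (λ v → Q (suc v) j₀ * sum (λ j → Q (suc w) j * L v j))
          ≈⟨ +-congˡ (-‿cong (sum-cong-≋ (λ v → trans (*-congˡ (inverse w w∈S v))
               (solve 3 (λ x d e → x :* (d :* e) := e :* (d :* x)) refl (Q (suc v) j₀) D (δ w v))))) ⟩
        D * Q (suc w) j₀ - sum (λ v → δ w v * (D * Q (suc v) j₀))
          ≈⟨ +-congˡ (-‿cong (sum-δ w (λ v → D * Q (suc v) j₀))) ⟩
        D * Q (suc w) j₀ - D * Q (suc w) j₀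
          ≈⟨ -‿inverseʳ _ ⟩
        0# ∎

      -- The old columns are scaled by `r` and corrected by a multiple of `u` until the new row `q`
      -- kills them. The new column is `D * u` rather than `u`, to give all columns the denominator
      -- `D * r`.
      L⁺ : Fin (suc n) → Fin m → Carrier
      L⁺ zero    j = D * u j
      L⁺ (suc v) j = r * L v j - α v * u j

      sum-L⁺zero : ∀ (a : Fin m → Carrier) → sum (λ j → a j * L⁺ zero j) ≈ D * sum (λ j → a j * u j)
      sum-L⁺zero a = trans
        (sum-cong-≋ (λ j → solve 3 (λ x d y → x :* (d :* y) := d :* (x :* y)) refl (a j) D (u j)))
        (sym (*-sum D (λ j → a j * u j)))

      sum-L⁺suc : ∀ (a : Fin m → Carrier) v → sum (λ j → a j * L⁺ (suc v) j) ≈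
                  r * sum (λ j → a j * L v j) - α v * sum (λ j → a j * u j)
      sum-L⁺suc a v = trans
        (sum-cong-≋ (λ j → solve 5 (λ x c l d y → x :* (c :* l :- d :* y) := c :* (x :* l) :- d :* (x :* y))
                               refl (a j) r (L v j) (α v) (u j)))
        (trans (sum-sub (λ j → r * (a j * L v j)) (λ j → α v * (a j * u j)))
               (+-cong (sym (*-sum r (λ j → a j * L v j)))
                       (-‿cong (sym (*-sum (α v) (λ j → a j * u j))))))

      L⁺-support : ∀ v → v ∉ inside ∷ S → ∀ j → L⁺ v j ≈ 0#
      L⁺-support zero v∉ j = contradiction here v∉
      L⁺-support (suc v) v∉ j = begin
        r * L v j - α v * u j
          ≈⟨ +-cong (*-congˡ (support v v∉S j)) (-‿cong (*-congʳ (α-support v v∉S))) ⟩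
        r * 0# - 0# * u j
          ≈⟨ +-cong (zeroʳ r) (-‿cong (zeroˡ _)) ⟩
        0# - 0#
          ≈⟨ -‿inverseʳ 0# ⟩
        0# ∎
        where v∉S = drop-not-there v∉

      L⁺-inverse : ∀ w → w ∈ inside ∷ S → ∀ v → sum (λ j → Q w j * L⁺ v j) ≈ (D * r) * δ w v
      L⁺-inverse zero w∈ zero = begin
        sum (λ j → q j * L⁺ zero j)   ≈⟨ sum-L⁺zero q ⟩
        D * sum (λ j → q j * u j)     ≈⟨ *-congˡ q·u ⟩
        D * r                         ≈⟨ sym (*-identityʳ _) ⟩
        (D * r) * 1#                  ∎
      L⁺-inverse zero w∈ (suc v) = begin
        sum (λ j → q j * L⁺ (suc v) j)              ≈⟨ sum-L⁺suc q v ⟩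
        r * α v - α v * sum (λ j → q j * u j)       ≈⟨ +-congˡ (-‿cong (*-congˡ q·u)) ⟩
        r * α v - α v * r                           ≈⟨ +-congʳ (*-comm _ _) ⟩
        α v * r - α v * r                           ≈⟨ -‿inverseʳ _ ⟩
        0#                                          ≈⟨ sym (zeroʳ _) ⟩
        (D * r) * 0#                                ∎
      L⁺-inverse (suc w) w∈ zero = begin
        sum (λ j → Q (suc w) j * L⁺ zero j)   ≈⟨ sum-L⁺zero (Q (suc w)) ⟩
        D * sum (λ j → Q (suc w) j * u j)     ≈⟨ *-congˡ (Q·u w (drop-there w∈)) ⟩
        D * 0#                                ≈⟨ zeroʳ _ ⟩
        0#                                    ≈⟨ sym (zeroʳ _) ⟩
        (D * r) * 0#                          ∎
      L⁺-inverse (suc w) w∈ (suc v) = begin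
        sum (λ j → Q (suc w) j * L⁺ (suc v) j)
          ≈⟨ sum-L⁺suc (Q (suc w)) v ⟩
        r * sum (λ j → Q (suc w) j * L v j) - α v * sum (λ j → Q (suc w) j * u j)
          ≈⟨ +-cong (*-congˡ (inverse w w∈S v)) (-‿cong (trans (*-congˡ (Q·u w w∈S)) (zeroʳ _))) ⟩
        r * (D * δ w v) - 0#
          ≈⟨ solve 3 (λ x d e → x :* (d :* e) :- con (+ 0) := (d :* x) :* e) refl r D (δ w v) ⟩
        (D * r) * δ w v
          ≈⟨ *-congˡ (sym (δ-suc w v)) ⟩
        (D * r) * δ (suc w) (suc v) ∎
        where
        w∈S = drop-there w∈

      rightInverse : RightInverse (inside ∷ S) Q
      rightInverse = record
        { denom = D * r ; denom-NZ = NZ-* D r denom-NZ r≉0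
        ; inv = L⁺ ; support = L⁺-support ; inverse = L⁺-inverse }

  dichotomy : ∀ {n m} (S : Subset n) (Q : Fin n → Fin m → Carrier) →
              Dependency S Q ⊎ RightInverse S Q
  dichotomy [] Q = inj₂ record
    { denom = 1# ; denom-NZ = NZ-1 ; inv = λ () ; support = λ () ; inverse = λ () }
  dichotomy (s ∷ S) Q with dichotomy S (λ v → Q (suc v))
  ... | inj₁ d = inj₁ record
    { coeff = λ { zero → 0# ; (suc v) → coeff v }
    ; support = λ { zero _ → refl ; (suc v) v∉ → support v (λ v∈ → v∉ (there v∈)) }
    ; pivot = suc pivot
    ; pivot-NZ = pivot-NZ
    ; relation = λ j → trans (+-cong (zeroˡ _) (relation j)) (+-identityˡ _)
    }
    where open Dependency d
  dichotomy (outside ∷ S) Q | inj₂ i = inj₂ record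
    { denom = denom
    ; denom-NZ = denom-NZ
    ; inv = λ { zero _ → 0# ; (suc v) → inv v }
    ; support = λ { zero _ _ → refl ; (suc v) v∉ → support v (λ v∈ → v∉ (there v∈)) }
    ; inverse = λ { zero () _
                  ; (suc u) u∈ zero → trans (sum-zero {f = λ j → Q (suc u) j * 0#} (λ j → zeroʳ _)) (sym (zeroʳ _))
                  ; (suc u) u∈ (suc v) → trans (inverse u (drop-there u∈) v) (*-congˡ (sym (δ-suc u v))) }
    }
    where open RightInverse i
  dichotomy (inside ∷ S) Q | inj₂ i with zero-or-exists (λ j → zero-or-NZ (Extend.residue S Q i j))
  ... | inj₁ r≈0 = inj₁ (Extend.dependency S Q i r≈0)
  ... | inj₂ (j₀ , r≉0) = inj₂ (Extend.rightInverse S Q i j₀ r≉0)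

-- Natural points with successively large coordinates.

-- An iterated product of the cofinite filter on ℕ: coordinate 0 is chosen last, and its bound may
-- depend on all the others.
Eventually : ∀ m → ((Fin m → ℕ) → Set) → Set
Eventually zero    A = A (λ ())
Eventually (suc m) A = Eventually m (λ x → ∃ λ N → ∀ k → N ≤ k → A (k V.∷ x))

Eventually-map : ∀ m {A B : (Fin m → ℕ) → Set} → (∀ x → A x → B x) → Eventually m A → Eventually m B
Eventually-map zero    f a = f (λ ()) a
Eventually-map (suc m) f a =
  Eventually-map m (λ x (N , h) → N , λ k N≤k → f (k V.∷ x) (h k N≤k)) a

Eventually-× : ∀ m {A B : (Fin m → ℕ) → Set} →
               Eventually m A → Eventually m B → Eventually m (λ x → A x × B x)
Eventually-× zero    a b = a , b
Eventually-× (suc m) a b = Eventually-map m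
  (λ x ((N , f) , (N′ , g)) → N ℕ.⊔ N′ , λ k ≤k →
    f k (ℕₚ.≤-trans (ℕₚ.m≤m⊔n N N′) ≤k) , g k (ℕₚ.≤-trans (ℕₚ.m≤n⊔m N N′) ≤k))
  (Eventually-× m a b)

Eventually-∃ : ∀ m {A : (Fin m → ℕ) → Set} → Eventually m A → ∃ A
Eventually-∃ zero    a = (λ ()) , a
Eventually-∃ (suc m) a with Eventually-∃ m a
... | x , N , f = (N V.∷ x) , f N ℕₚ.≤-refl

Eventually-pure : ∀ m {A : (Fin m → ℕ) → Set} → (∀ x → A x) → Eventually m A
Eventually-pure zero    a = a (λ ())
Eventually-pure (suc m) a = Eventually-pure m (λ x → 0 , λ k _ → a (k V.∷ x))

-- A nonzero integer has absolute value at least 1, so `k * d` outweighs `c`. This use of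
-- integrality replaces any counting of roots.
large-multiple-≢ : ∀ (c d : ℤ) k → suc ℤ.∣ c ∣ ≤ k → d ≢ + 0 → c ℤ.+ + k ℤ.* d ≢ + 0
large-multiple-≢ c d k c<k d≢0 eq = ℕₚ.<-irrefl ≡.refl (begin-strict
  ℤ.∣ c ∣             <⟨ c<k ⟩
  k                   ≡⟨ ≡.sym (ℕₚ.*-identityʳ k) ⟩
  k ℕ.* 1             ≤⟨ ℕₚ.*-monoʳ-≤ k (ℕₚ.n≢0⇒n>0 (λ e → d≢0 (ℤₚ.∣i∣≡0⇒i≡0 e))) ⟩
  k ℕ.* ℤ.∣ d ∣       ≡⟨ ≡.sym (ℤₚ.abs-* (+ k) d) ⟩
  ℤ.∣ + k ℤ.* d ∣     ≡⟨ ≡.sym (ℤₚ.∣-i∣≡∣i∣ (+ k ℤ.* d)) ⟩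
  ℤ.∣ ℤ.- (+ k ℤ.* d) ∣ ≡⟨ ≡.cong ℤ.∣_∣ (≡.sym c≡) ⟩
  ℤ.∣ c ∣             ∎)
  where
  open ℕₚ.≤-Reasoning
  c≡ : c ≡ ℤ.- (+ k ℤ.* d)
  c≡ = ℤₚ.i-j≡0⇒i≡j c _ (≡.trans (≡.cong (λ z → c ℤ.+ z) (ℤₚ.neg-involutive _)) eq)

-- Integer polynomials, as expressions and as coefficient lists.

-- Elimination runs on expressions up to equality of values; only the zero test passes to
-- coefficient lists.
data Expr (m : ℕ) : Set where
  con : ℤ → Expr m
  var : Fin m → Expr m
  _⊕_ _⊛_ : Expr m → Expr m → Expr m
  ⊝_ : Expr m → Expr m

-- The variable 0 is the outermost one.
Dense : ℕ → Set
Dense zero    = ℤ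
Dense (suc m) = List (Dense m)

conᴰ : ∀ {m} → ℤ → Dense m
conᴰ {zero}  c = c
conᴰ {suc m} c = conᴰ c ∷ []

varᴰ : ∀ {m} → Fin m → Dense m
varᴰ zero    = conᴰ (+ 0) ∷ conᴰ (+ 1) ∷ []
varᴰ (suc i) = varᴰ i ∷ []

module _ {A : Set} (_+ᶜ_ : A → A → A) where
  addList : List A → List A → List A
  addList []       q        = q
  addList (c ∷ p)  []       = c ∷ p
  addList (c ∷ p)  (d ∷ q)  = (c +ᶜ d) ∷ addList p q

addᴰ : ∀ {m} → Dense m → Dense m → Dense m
addᴰ {zero}  = ℤ._+_
addᴰ {suc m} = addList (addᴰ {m})

module _ {A : Set} (_+ᶜ_ _*ᶜ_ : A → A → A) (0ᶜ : A) where
  mulList : List A → List A → List A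
  mulList []      q = []
  mulList (c ∷ p) q = addList _+ᶜ_ (map (c *ᶜ_) q) (0ᶜ ∷ mulList p q)

mulᴰ : ∀ {m} → Dense m → Dense m → Dense m
mulᴰ {zero}  = ℤ._*_
mulᴰ {suc m} = mulList (addᴰ {m}) (mulᴰ {m}) (conᴰ (+ 0))

negᴰ : ∀ {m} → Dense m → Dense m
negᴰ = mulᴰ (conᴰ (ℤ.- (+ 1)))

dense : ∀ {m} → Expr m → Dense m
dense (con c) = conᴰ c
dense (var i) = varᴰ i
dense (p ⊕ q) = addᴰ (dense p) (dense q)
dense (p ⊛ q) = mulᴰ (dense p) (dense q)
dense (⊝ p)   = negᴰ (dense p)

evalℤ-list : ∀ {A : Set} → (A → ℤ) → ℤ → List A → ℤ
evalℤ-list e x []      = + 0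
evalℤ-list e x (c ∷ p) = e c ℤ.+ x ℤ.* evalℤ-list e x p

evalℤ : ∀ {m} → Dense m → (Fin m → ℕ) → ℤ
evalℤ {zero}  c x = c
evalℤ {suc m} p x = evalℤ-list (λ c → evalℤ {m} c (λ i → x (suc i))) (+ x zero) p

-- Values of integer polynomials in `K`, and the zero test.

module Polynomials (K : ACField) where
  open ACField K hiding (zero)
  open Integers cring
  open Solver using (solve; _:=_; _:+_; _:*_; _:-_; :-_) renaming (con to :con)
  open import Relation.Binary.Reasoning.Setoid setoid
  open Mult semiring using () renaming (_×_ to _·_)

  natK≡ι : ∀ n → natK n ≡ ι (+ n)
  natK≡ι zero    = ≡.refl
  natK≡ι (suc n) = ≡.cong (λ z → 1# + z) (natK≡ι n)

  ι-≉0 : ∀ {i} → i ≢ + 0 → ¬ ι i ≈ 0#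
  ι-≉0 {+ zero}  i≢0 _ = i≢0 ≡.refl
  ι-≉0 {+ suc n} i≢0 e = char0 n (trans (reflexive (natK≡ι (suc n))) e)
  ι-≉0 { -[1+ n ]} i≢0 e = char0 n (begin
    natK (suc n)          ≡⟨ natK≡ι (suc n) ⟩
    suc n · 1#            ≈⟨ solve 1 (λ x → x := :- (:- x)) refl _ ⟩
    - (- (suc n · 1#))    ≈⟨ -‿cong e ⟩
    - 0#                  ≈⟨ solve 0 (:- :con (+ 0) := :con (+ 0)) refl ⟩
    0#                    ∎)

  -- The inverse of `x` is explicit, so the conclusion is a positive equation and no double negation
  -- has to be removed.
  cancel-≉0 : ∀ {x y} → ¬ x ≈ 0# → x * y ≈ 0# → y ≈ 0#
  cancel-≉0 {x} {y} x≉0 xy≈0 = begin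
    y                ≈⟨ sym (*-identityˡ y) ⟩
    1# * y           ≈⟨ *-congʳ (sym (proj₂ (inverse x x≉0))) ⟩
    (x * z) * y      ≈⟨ solve 3 (λ x y z → (x :* z) :* y := z :* (x :* y)) refl x y z ⟩
    z * (x * y)      ≈⟨ *-congˡ xy≈0 ⟩
    z * 0#           ≈⟨ zeroʳ z ⟩
    0#               ∎
    where z = proj₁ (inverse x x≉0)

  *-≉0 : ∀ {x y} → ¬ x ≈ 0# → ¬ y ≈ 0# → ¬ x * y ≈ 0#
  *-≉0 x≉0 y≉0 xy≈0 = y≉0 (cancel-≉0 x≉0 xy≈0)

  eval : ∀ {m} → Expr m → (Fin m → Carrier) → Carrier
  eval (con c) x = ι c
  eval (var i) x = x i
  eval (p ⊕ q) x = eval p x + eval q x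
  eval (p ⊛ q) x = eval p x * eval q x
  eval (⊝ p)   x = - eval p x

  eval-cong : ∀ {m} (p : Expr m) {x y : Fin m → Carrier} → (∀ i → x i ≈ y i) → eval p x ≈ eval p y
  eval-cong (con c) e = refl
  eval-cong (var i) e = e i
  eval-cong (p ⊕ q) e = +-cong (eval-cong p e) (eval-cong q e)
  eval-cong (p ⊛ q) e = *-cong (eval-cong p e) (eval-cong q e)
  eval-cong (⊝ p)   e = -‿cong (eval-cong p e)

  evalList : ∀ {A : Set} → (A → Carrier) → Carrier → List A → Carrier
  evalList e x []      = 0#
  evalList e x (c ∷ p) = e c + x * evalList e x p

  evalᴰ : ∀ {m} → Dense m → (Fin m → Carrier) → Carrier
  evalᴰ {zero}  c x = ι c
  evalᴰ {suc m} p x = evalList (λ c → evalᴰ {m} c (λ i → x (suc i))) (x zero) p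

  eval-con : ∀ {m} c (x : Fin m → Carrier) → evalᴰ (conᴰ c) x ≈ ι c
  eval-con {zero}  c x = refl
  eval-con {suc m} c x = trans (+-cong (eval-con c (λ i → x (suc i))) (zeroʳ _)) (+-identityʳ _)

  eval-var : ∀ {m} i (x : Fin m → Carrier) → evalᴰ (varᴰ i) x ≈ x i
  eval-var zero x = begin
    evalᴰ (conᴰ (+ 0)) x⁺ + x zero * (evalᴰ (conᴰ (+ 1)) x⁺ + x zero * 0#)
      ≈⟨ +-cong (eval-con (+ 0) x⁺) (*-congˡ (+-congʳ (eval-con (+ 1) x⁺))) ⟩
    0# + x zero * (ι (+ 1) + x zero * 0#)
      ≈⟨ solve 1 (λ a → :con (+ 0) :+ a :* (:con (+ 1) :+ a :* :con (+ 0)) := a) refl (x zero) ⟩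
    x zero ∎
    where x⁺ = λ i → x (suc i)
  eval-var (suc i) x = trans (+-cong (eval-var i (λ i → x (suc i))) (zeroʳ _)) (+-identityʳ _)

  module _ {A : Set} (_+ᶜ_ : A → A → A) (e : A → Carrier) (e-+ : ∀ a b → e (a +ᶜ b) ≈ e a + e b)
           (x : Carrier) where
    evalList-add : ∀ p q → evalList e x (addList _+ᶜ_ p q) ≈ evalList e x p + evalList e x q
    evalList-add []      q       = sym (+-identityˡ _)
    evalList-add (c ∷ p) []      = sym (+-identityʳ _)
    evalList-add (c ∷ p) (d ∷ q) = begin
      e (c +ᶜ d) + x * evalList e x (addList _+ᶜ_ p q)
        ≈⟨ +-cong (e-+ c d) (*-congˡ (evalList-add p q)) ⟩
      (e c + e d) + x * (evalList e x p + evalList e x q)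
        ≈⟨ solve 5 (λ c d x p q → (c :+ d) :+ x :* (p :+ q) := (c :+ x :* p) :+ (d :+ x :* q)) refl
             (e c) (e d) x _ _ ⟩
      (e c + x * evalList e x p) + (e d + x * evalList e x q) ∎

    module _ (_*ᶜ_ : A → A → A) (e-* : ∀ a b → e (a *ᶜ b) ≈ e a * e b) (0ᶜ : A) (e-0 : e 0ᶜ ≈ 0#) where
      evalList-map : ∀ c q → evalList e x (map (c *ᶜ_) q) ≈ e c * evalList e x q
      evalList-map c []      = sym (zeroʳ _)
      evalList-map c (d ∷ q) = begin
        e (c *ᶜ d) + x * evalList e x (map (c *ᶜ_) q)
          ≈⟨ +-cong (e-* c d) (*-congˡ (evalList-map c q)) ⟩
        e c * e d + x * (e c * evalList e x q)
          ≈⟨ solve 4 (λ c d x q → c :* d :+ x :* (c :* q) := c :* (d :+ x :* q)) refl (e c) (e d) x _ ⟩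
        e c * (e d + x * evalList e x q) ∎

      evalList-mul : ∀ p q → evalList e x (mulList _+ᶜ_ _*ᶜ_ 0ᶜ p q) ≈ evalList e x p * evalList e x q
      evalList-mul []      q = sym (zeroˡ _)
      evalList-mul (c ∷ p) q = begin
        evalList e x (addList _+ᶜ_ (map (c *ᶜ_) q) (0ᶜ ∷ mulList _+ᶜ_ _*ᶜ_ 0ᶜ p q))
          ≈⟨ evalList-add (map (c *ᶜ_) q) _ ⟩
        evalList e x (map (c *ᶜ_) q) + (e 0ᶜ + x * evalList e x (mulList _+ᶜ_ _*ᶜ_ 0ᶜ p q))
          ≈⟨ +-cong (evalList-map c q) (+-cong e-0 (*-congˡ (evalList-mul p q))) ⟩
        e c * evalList e x q + (0# + x * (evalList e x p * evalList e x q))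
          ≈⟨ solve 4 (λ c x p q → c :* q :+ (:con (+ 0) :+ x :* (p :* q)) := (c :+ x :* p) :* q) refl
               (e c) x _ _ ⟩
        (e c + x * evalList e x p) * evalList e x q ∎

  eval-add : ∀ {m} p q (x : Fin m → Carrier) → evalᴰ (addᴰ p q) x ≈ evalᴰ p x + evalᴰ q x
  eval-add {zero}  p q x = ι-+ p q
  eval-add {suc m} p q x = evalList-add (addᴰ {m}) _ (λ a b → eval-add a b _) (x zero) p q

  eval-mul : ∀ {m} p q (x : Fin m → Carrier) → evalᴰ (mulᴰ p q) x ≈ evalᴰ p x * evalᴰ q x
  eval-mul {zero}  p q x = ι-* p q
  eval-mul {suc m} p q x =
    evalList-mul (addᴰ {m}) _ (λ a b → eval-add a b _) (x zero)
                 (mulᴰ {m}) (λ a b → eval-mul a b _) (conᴰ (+ 0)) (eval-con (+ 0) (λ i → x (suc i))) p q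

  eval-dense : ∀ {m} (p : Expr m) x → evalᴰ (dense p) x ≈ eval p x
  eval-dense (con c) x = eval-con c x
  eval-dense (var i) x = eval-var i x
  eval-dense (p ⊕ q) x = trans (eval-add (dense p) (dense q) x) (+-cong (eval-dense p x) (eval-dense q x))
  eval-dense (p ⊛ q) x = trans (eval-mul (dense p) (dense q) x) (*-cong (eval-dense p x) (eval-dense q x))
  eval-dense (⊝ p)   x = begin
    evalᴰ (mulᴰ (conᴰ (ℤ.- (+ 1))) (dense p)) x        ≈⟨ eval-mul (conᴰ (ℤ.- (+ 1))) (dense p) x ⟩
    evalᴰ (conᴰ (ℤ.- (+ 1))) x * evalᴰ (dense p) x     ≈⟨ *-cong (eval-con (ℤ.- (+ 1)) x) (eval-dense p x) ⟩
    ι (ℤ.- (+ 1)) * eval p x                           ≈⟨ solve 1 (λ a → :con (ℤ.- (+ 1)) :* a := :- a) refl _ ⟩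
    - eval p x ∎

  natPoint : ∀ {m} → (Fin m → ℕ) → Fin m → Carrier
  natPoint x i = ι (+ x i)

  ι-evalℤ : ∀ {m} (p : Dense m) (x : Fin m → ℕ) → ι (evalℤ p x) ≈ evalᴰ p (natPoint x)
  ι-evalℤ {zero}  p x = refl
  ι-evalℤ {suc m} p x = go p
    where
    go : ∀ p → ι (evalℤ-list (λ c → evalℤ {m} c (λ i → x (suc i))) (+ x zero) p)
             ≈ evalList (λ c → evalᴰ {m} c (λ i → natPoint x (suc i))) (natPoint x zero) p
    go []      = refl
    go (c ∷ p) = trans (ι-+ (evalℤ c (λ i → x (suc i))) _)
                   (+-cong (ι-evalℤ c (λ i → x (suc i)))
                           (trans (ι-* (+ x zero) _) (*-congˡ (go p))))

  -- The elimination needs the first half; the second lets the zero test discard the tail of a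
  -- Horner form at integer points.
  Vanishing : ∀ {m} → Dense m → Set
  Vanishing p = (∀ x → evalᴰ p x ≈ 0#) × (∀ x → evalℤ p x ≡ + 0)

  -- In `c + x * p`, if `p` is eventually nonzero then `x` times its integer value outweighs `c`; if
  -- `p` vanishes, then `c` decides. Trailing zero coefficients do no harm.
  vanishing-or-≢ : ∀ {m} (p : Dense m) → Vanishing p ⊎ Eventually m (λ x → evalℤ p x ≢ + 0)
  vanishing-or-≢ {zero} c with c ℤₚ.≟ + 0
  ... | yes ≡.refl = inj₁ ((λ _ → refl) , λ _ → ≡.refl)
  ... | no c≢0     = inj₂ c≢0
  vanishing-or-≢ {suc m} [] = inj₁ ((λ _ → refl) , λ _ → ≡.refl)
  vanishing-or-≢ {suc m} (c ∷ p) with vanishing-or-≢ {suc m} p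
  ... | inj₂ p≢0 = inj₂ (Eventually-map m
    (λ x (N , h) → N ℕ.⊔ suc ℤ.∣ evalℤ c x ∣ , λ k ≤k →
       large-multiple-≢ (evalℤ c x) (evalℤ p (k V.∷ x)) k
         (ℕₚ.≤-trans (ℕₚ.m≤n⊔m N _) ≤k) (h k (ℕₚ.≤-trans (ℕₚ.m≤m⊔n N _) ≤k)))
    p≢0)
  ... | inj₁ (pᴷ≈0 , pℤ≡0) with vanishing-or-≢ c
  ...   | inj₁ (cᴷ≈0 , cℤ≡0) = inj₁
    ( (λ x → trans (+-cong (cᴷ≈0 _) (trans (*-congˡ (pᴷ≈0 x)) (zeroʳ _))) (+-identityʳ _))
    , (λ x → ≡.cong₂ ℤ._+_ (cℤ≡0 _) (≡.trans (≡.cong (+ x zero ℤ.*_) (pℤ≡0 x)) (ℤₚ.*-zeroʳ (+ x zero)))))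
  ...   | inj₂ c≢0 = inj₂ (Eventually-map m
    (λ x cx≢0 → 0 , λ k _ eq → cx≢0 (≡.trans (≡.sym (≡.trans
       (≡.cong (λ z → evalℤ c x ℤ.+ z)
         (≡.trans (≡.cong (+ k ℤ.*_) (pℤ≡0 (k V.∷ x))) (ℤₚ.*-zeroʳ (+ k))))
       (ℤₚ.+-identityʳ _))) eq))
    c≢0)

  -- With equality of functions on `K`, the ring laws hold pointwise and every identity found by
  -- elimination can be evaluated at any point.
  _≃_ : ∀ {m} → Expr m → Expr m → Set
  p ≃ q = ∀ x → eval p x ≈ eval q x

  record NonVanishing {m} (p : Expr m) : Set where
    constructor nonVanishing
    field eventually : Eventually m (λ x → ¬ eval p (natPoint x) ≈ 0#)
  open NonVanishing public

  zero-or-nonVanishing : ∀ {m} (p : Expr m) → (p ≃ con (+ 0)) ⊎ NonVanishing p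
  zero-or-nonVanishing {m} p with vanishing-or-≢ (dense p)
  ... | inj₁ (pᴷ≈0 , _) = inj₁ (λ x → trans (sym (eval-dense p x)) (pᴷ≈0 x))
  ... | inj₂ p≢0 = inj₂ (nonVanishing (Eventually-map m
    (λ x px≢0 e → ι-≉0 px≢0 (trans (ι-evalℤ (dense p) x) (trans (eval-dense p _) e))) p≢0))

  nonVanishing-1 : ∀ {m} → NonVanishing {m} (con (+ 1))
  nonVanishing-1 {m} = nonVanishing (Eventually-pure m (λ x e → 1≉0 (trans (sym ι-1) e)))

  nonVanishing-* : ∀ {m} (p q : Expr m) → NonVanishing p → NonVanishing q → NonVanishing (p ⊛ q)
  nonVanishing-* {m} p q np nq =
    nonVanishing (Eventually-map m (λ x (a , b) → *-≉0 a b) (Eventually-× m (eventually np) (eventually nq)))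

  exprRing : ℕ → CommutativeRing 0ℓ 0ℓ
  exprRing m = record
    { Carrier = Expr m ; _≈_ = _≃_ ; _+_ = _⊕_ ; _*_ = _⊛_ ; -_ = ⊝_ ; 0# = con (+ 0) ; 1# = con (+ 1)
    ; isCommutativeRing = record
      { isRing = record
        { +-isAbelianGroup = record
          { isGroup = record
            { isMonoid = record
              { isSemigroup = record
                { isMagma = record
                  { isEquivalence = record
                    { refl = λ x → refl ; sym = λ e x → sym (e x) ; trans = λ e f x → trans (e x) (f x) }
                  ; ∙-cong = λ e f x → +-cong (e x) (f x) }
                ; assoc = λ p q r x → +-assoc _ _ _ }
              ; identity = (λ p x → +-identityˡ _) , (λ p x → +-identityʳ _) }
            ; inverse = (λ p x → -‿inverseˡ _) , (λ p x → -‿inverseʳ _)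
            ; ⁻¹-cong = λ e x → -‿cong (e x) }
          ; comm = λ p q x → +-comm _ _ }
        ; *-cong = λ e f x → *-cong (e x) (f x)
        ; *-assoc = λ p q r x → *-assoc _ _ _
        ; *-identity = (λ p x → trans (*-congʳ ι-1) (*-identityˡ _))
                     , (λ p x → trans (*-congˡ ι-1) (*-identityʳ _))
        ; distrib = (λ p q r x → distribˡ _ _ _) , (λ p q r x → distribʳ _ _ _) }
      ; *-comm = λ p q x → *-comm _ _ } }

module ℤΣ = Sums ℤₚ.+-*-commutativeRing

-- Sums over the support of a 0-1 function.

module Support (R : CommutativeRing 0ℓ 0ℓ) {n e : ℕ} (G : Graph n e) where
  open CommutativeRing R hiding (zero)
  open Sums R

  sumList : ∀ {m} → (Fin m → Carrier) → List (Fin m) → Carrier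
  sumList f []      = 0#
  sumList f (x ∷ l) = f x + sumList f l

  sumList-map-suc : ∀ {m} (f : Fin (suc m) → Carrier) l → sumList f (map suc l) ≈ sumList (f ∘ suc) l
  sumList-map-suc f []      = refl
  sumList-map-suc f (x ∷ l) = +-congˡ (sumList-map-suc f l)

  -- For the multiplicities of the edge-ends at a vertex, `length≡` turns degree 3 into three named
  -- edges and `sum≈` reduces sums over all edges to them.
  record SupportList {m} (d : Fin m → ℕ) : Set where
    field
      list    : List (Fin m)
      length≡ : length list ≡ countFin G d
      unique  : Unique list
      member  : All (λ x → d x ≢ 0) list
      sum≈    : ∀ (f : Fin m → Carrier) → (∀ x → d x ≡ 0 → f x ≈ 0#) → sum f ≈ sumList f list

  supportList : ∀ {m} (d : Fin m → ℕ) → (∀ x → d x ≤ 1) → SupportList d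
  supportList {zero} d d≤1 = record
    { list = [] ; length≡ = ≡.refl ; unique = [] ; member = [] ; sum≈ = λ _ _ → refl }
  supportList {suc m} d d≤1 with d zero in eq | d≤1 zero | supportList (d ∘ suc) (d≤1 ∘ suc)
  ... | 0 | _ | r = record
    { list = map suc list
    ; length≡ = ≡.trans (≡.trans (length-map suc list) length≡)
                        (≡.cong (ℕ._+ countFin G (d ∘ suc)) (≡.sym eq))
    ; unique = Uniqueₚ.map⁺ suc-injective unique
    ; member = Allₚ.map⁺ member
    ; sum≈ = λ f f≈0 → trans (+-cong (f≈0 zero eq) (sum≈ (f ∘ suc) (f≈0 ∘ suc)))
                       (trans (+-identityˡ _) (sym (sumList-map-suc f list)))
    }
    where open SupportList r
  ... | 1 | _ | r = record
    { list = zero ∷ map suc list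
    ; length≡ = ≡.trans (≡.cong suc (≡.trans (length-map suc list) length≡))
                        (≡.cong (ℕ._+ countFin G (d ∘ suc)) (≡.sym eq))
    ; unique = Allₚ.map⁺ (All.universal (λ _ ()) list) ∷ Uniqueₚ.map⁺ suc-injective unique
    ; member = (λ d≡0 → contradiction (≡.trans (≡.sym eq) d≡0) λ ()) ∷ Allₚ.map⁺ member
    ; sum≈ = λ f f≈0 → +-congˡ (trans (sum≈ (f ∘ suc) (f≈0 ∘ suc)) (sym (sumList-map-suc f list)))
    }
    where open SupportList r
  ... | suc (suc _) | s≤s () | _

-- Flows, paths and cycles in the graph.

module Flows (K : ACField) {n e : ℕ} (G : Graph n e)
             (trivalent : Trivalent G) (connected : ThreeConnected G) where
  open ACField K hiding (zero)
  open Graph G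
  open Integers cring
  open Sums cring
  open Solver using (solve; _:=_; _:+_; _:*_; _:-_; :-_) renaming (con to :con)
  open Support cring G
  open import Relation.Binary.Reasoning.Setoid setoid

  tail head : Fin e → Fin n
  tail x = proj₁ (ends x)
  head x = proj₂ (ends x)

  loopless : ∀ x → tail x ≢ head x
  loopless = proj₁ (proj₁ connected)

  Inc : Fin n → Fin e → Set
  Inc = Lin.Incident K G

  ε : Fin n → Fin e → Carrier
  ε v x = δ (head x) v - δ (tail x) v

  ∂ : (Fin e → Carrier) → Fin n → Carrier
  ∂ z v = sum (λ x → ε v x * z x)

  IsFlow : (Fin e → Carrier) → Set
  IsFlow z = ∀ v → ∂ z v ≈ 0#

  ∂-cong : ∀ {y z} → (∀ x → y x ≈ z x) → ∀ v → ∂ y v ≈ ∂ z v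
  ∂-cong y≈z v = sum-cong-≋ (λ x → *-congˡ (y≈z x))

  ∂-+ : ∀ y z v → ∂ (λ x → y x + z x) v ≈ ∂ y v + ∂ z v
  ∂-+ y z v = trans (sum-cong-≋ (λ x → distribˡ (ε v x) (y x) (z x))) (sum-+ (λ x → ε v x * y x) _)

  ∂-* : ∀ c z v → ∂ (λ x → c * z x) v ≈ c * ∂ z v
  ∂-* c z v = trans (sum-cong-≋ (λ x → solve 3 (λ a c z → a :* (c :* z) := c :* (a :* z)) refl (ε v x) c (z x)))
                    (sym (*-sum c (λ x → ε v x * z x)))

  ∂-δ : ∀ a v → ∂ (δ a) v ≈ ε v a
  ∂-δ a v = trans (sum-cong-≋ (λ x → *-comm (ε v x) (δ a x))) (sum-δ a (ε v))

  sum-δ-1 : ∀ {m} (a : Fin m) → sum (δ a) ≈ 1#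
  sum-δ-1 a = trans (sum-cong-≋ (λ i → sym (*-identityʳ (δ a i)))) (sum-δ a (λ _ → 1#))

  sum-ε : ∀ x → sum (λ v → ε v x) ≈ 0#
  sum-ε x = begin
    sum (λ v → δ (head x) v - δ (tail x) v)    ≈⟨ sum-sub (δ (head x)) (δ (tail x)) ⟩
    sum (δ (head x)) - sum (δ (tail x))        ≈⟨ +-cong (sum-δ-1 (head x)) (-‿cong (sum-δ-1 (tail x))) ⟩
    1# - 1#                                    ≈⟨ -‿inverseʳ 1# ⟩
    0#                                         ∎

  ε-off : ∀ {v x} → ¬ Inc v x → ε v x ≈ 0#
  ε-off ¬inc = trans (+-cong (δ-≢ (¬inc ∘ inj₂)) (-‿cong (δ-≢ (¬inc ∘ inj₁)))) (-‿inverseʳ 0#)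

  ε-tail : ∀ x → ε (tail x) x ≈ - 1#
  ε-tail x = trans (+-cong (δ-≢ (loopless x ∘ ≡.sym)) (-‿cong (δ-refl (tail x)))) (+-identityˡ _)

  ε-head : ∀ x → ε (head x) x ≈ 1#
  ε-head x = trans (+-cong (δ-refl (head x)) (-‿cong (δ-≢ (loopless x))))
                   (solve 1 (λ a → a :- :con (+ 0) := a) refl 1#)

  ε² : ∀ {v x} → Inc v x → ε v x * ε v x ≈ 1#
  ε² {v} {x} (inj₁ ≡.refl) = trans (*-cong (ε-tail x) (ε-tail x))
    (trans (solve 1 (λ a → :- a :* :- a := a :* a) refl 1#) (*-identityˡ 1#))
  ε² {v} {x} (inj₂ ≡.refl) = trans (*-cong (ε-head x) (ε-head x)) (*-identityˡ 1#)

  -- Integer-valued, so that flows built from paths can serve as constants in `Expr`.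
  chain : ∀ {S u w} → Walk G S u w → Fin e → ℤ
  chain here          y = + 0
  chain (fwd x _ _ p) y = ℤΣ.δ x y ℤ.+ chain p y
  chain (bwd x _ _ p) y = ℤ.- ℤΣ.δ x y ℤ.+ chain p y

  ι-δ : ∀ {m} (a b : Fin m) → ι (ℤΣ.δ a b) ≈ δ a b
  ι-δ a b with does (a ≟ b)
  ... | true  = ι-1
  ... | false = refl

  ∂-chain : ∀ {S u w} (p : Walk G S u w) v → ∂ (ι ∘ chain p) v ≈ δ w v - δ u v
  ∂-chain here v = trans (sum-zero {f = λ x → ε v x * 0#} (λ x → zeroʳ _)) (sym (-‿inverseʳ _))
  ∂-chain {w = w} (fwd x ≡.refl _ p) v = begin
    ∂ (λ y → ι (ℤΣ.δ x y ℤ.+ chain p y)) v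
      ≈⟨ ∂-cong (λ y → trans (ι-+ (ℤΣ.δ x y) (chain p y)) (+-congʳ (ι-δ x y))) v ⟩
    ∂ (λ y → δ x y + ι (chain p y)) v
      ≈⟨ ∂-+ (δ x) (ι ∘ chain p) v ⟩
    ∂ (δ x) v + ∂ (ι ∘ chain p) v
      ≈⟨ +-cong (∂-δ x v) (∂-chain p v) ⟩
    (δ (head x) v - δ (tail x) v) + (δ w v - δ (head x) v)
      ≈⟨ solve 3 (λ h t w → (h :- t) :+ (w :- h) := w :- t) refl (δ (head x) v) (δ (tail x) v) (δ w v) ⟩
    δ w v - δ (tail x) v ∎
  ∂-chain {w = w} (bwd x ≡.refl _ p) v = begin
    ∂ (λ y → ι (ℤ.- ℤΣ.δ x y ℤ.+ chain p y)) v
      ≈⟨ ∂-cong (λ y → trans (ι-+ (ℤ.- ℤΣ.δ x y) (chain p y))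
           (+-congʳ (trans (ι-neg (ℤΣ.δ x y)) (trans (-‿cong (ι-δ x y)) (sym (-1*x≈-x (δ x y))))))) v ⟩
    ∂ (λ y → - 1# * δ x y + ι (chain p y)) v
      ≈⟨ ∂-+ (λ y → - 1# * δ x y) (ι ∘ chain p) v ⟩
    ∂ (λ y → - 1# * δ x y) v + ∂ (ι ∘ chain p) v
      ≈⟨ +-cong (trans (∂-* (- 1#) (δ x) v) (trans (-1*x≈-x _) (-‿cong (∂-δ x v)))) (∂-chain p v) ⟩
    - (δ (head x) v - δ (tail x) v) + (δ w v - δ (tail x) v)
      ≈⟨ solve 3 (λ h t w → :- (h :- t) :+ (w :- t) := w :- h) refl (δ (head x) v) (δ (tail x) v) (δ w v) ⟩
    δ w v - δ (head x) v ∎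
    where open import Algebra.Properties.Ring ring using (-1*x≈-x)

  -- Every edge used by the walk has both ends outside `S`. A `Walk` excludes `S` only for the
  -- vertices it enters, hence the separate hypothesis on `u`.
  chain-avoids : ∀ {S u w s y} (p : Walk G S u w) → u ∉ S → s ∈ S → Inc s y → chain p y ≡ + 0
  chain-avoids here u∉S s∈S inc = ≡.refl
  chain-avoids {S = S} {y = y} (fwd x ≡.refl v∉S p) u∉S s∈S inc with x ≟ y
  ... | yes ≡.refl = ⊥-elim ([ (λ { ≡.refl → u∉S s∈S }) , (λ { ≡.refl → v∉S s∈S }) ]′ inc)
  ... | no _ = ≡.trans (ℤₚ.+-identityˡ _) (chain-avoids p v∉S s∈S inc)
  chain-avoids {S = S} {y = y} (bwd x ≡.refl v∉S p) u∉S s∈S inc with x ≟ y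
  ... | yes ≡.refl = ⊥-elim ([ (λ { ≡.refl → v∉S s∈S }) , (λ { ≡.refl → u∉S s∈S }) ]′ inc)
  ... | no _ = ≡.trans (ℤₚ.+-identityˡ _) (chain-avoids p v∉S s∈S inc)

  root : Fin n
  root = fromℕ< {0} (ℕₚ.≤-trans (s≤s z≤n) (proj₁ (proj₂ connected)))

  path : ∀ v → Walk G ∅ root v
  path v = proj₂ (proj₂ connected) ∅ (≡.subst (_≤ 2) (≡.sym (∣⊥∣≡0 n)) z≤n) root v ∉⊥ ∉⊥

  ℓ : Fin n → Fin e → Carrier
  ℓ v x = ι (chain (path v) x)

  -- Row j is the projection of the j-th unit vector to the flows along the chosen paths.
  basicℤ : Fin e → Fin e → ℤ
  basicℤ j x = ℤΣ.δ j x ℤ.- ℤΣ.sum (λ v → (ℤΣ.δ (head j) v ℤ.- ℤΣ.δ (tail j) v) ℤ.* chain (path v) x)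

  basic : Fin e → Fin e → Carrier
  basic j x = ι (basicℤ j x)

  ι-sub : ∀ i j → ι (i ℤ.- j) ≈ ι i - ι j
  ι-sub i j = trans (ι-+ i (ℤ.- j)) (+-congˡ (ι-neg j))

  ι-sum : ∀ {m} (f : Fin m → ℤ) → ι (ℤΣ.sum f) ≈ sum (ι ∘ f)
  ι-sum {zero}  f = refl
  ι-sum {suc m} f = trans (ι-+ (f zero) _) (+-congˡ (ι-sum (f ∘ suc)))

  basic≈ : ∀ j x → basic j x ≈ δ j x - sum (λ v → ε v j * ℓ v x)
  basic≈ j x = begin
    ι (basicℤ j x)
      ≈⟨ ι-sub (ℤΣ.δ j x) _ ⟩
    ι (ℤΣ.δ j x) - ι (ℤΣ.sum c)
      ≈⟨ +-cong (ι-δ j x) (-‿cong (trans (ι-sum c) (sum-cong-≋ (λ v →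
           trans (ι-* (ℤΣ.δ (head j) v ℤ.- ℤΣ.δ (tail j) v) (chain (path v) x))
                 (*-congʳ (trans (ι-sub (ℤΣ.δ (head j) v) (ℤΣ.δ (tail j) v))
                                 (+-cong (ι-δ (head j) v) (-‿cong (ι-δ (tail j) v))))))))) ⟩
    δ j x - sum (λ v → ε v j * ℓ v x) ∎
    where c = λ v → (ℤΣ.δ (head j) v ℤ.- ℤΣ.δ (tail j) v) ℤ.* chain (path v) x

  sum-basic : ∀ (z : Fin e → Carrier) j →
              sum (λ x → z x * basic j x) ≈ z j - sum (λ v → ε v j * sum (λ x → z x * ℓ v x))
  sum-basic z j = begin
    sum (λ x → z x * basic j x)
      ≈⟨ sum-cong-≋ (λ x → trans (*-congˡ (basic≈ j x))
           (solve 3 (λ z d s → z :* (d :- s) := d :* z :- z :* s) refl (z x) (δ j x) _)) ⟩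
    sum (λ x → δ j x * z x - z x * sum (λ v → ε v j * ℓ v x))
      ≈⟨ sum-sub (λ x → δ j x * z x) _ ⟩
    sum (λ x → δ j x * z x) - sum (λ x → z x * sum (λ v → ε v j * ℓ v x))
      ≈⟨ +-cong (sum-δ j z) (-‿cong (begin
           sum (λ x → z x * sum (λ v → ε v j * ℓ v x))
             ≈⟨ sum-cong-≋ (λ x → *-sum (z x) (λ v → ε v j * ℓ v x)) ⟩
           sum (λ x → sum (λ v → z x * (ε v j * ℓ v x)))
             ≈⟨ sum-swap (λ x v → z x * (ε v j * ℓ v x)) ⟩
           sum (λ v → sum (λ x → z x * (ε v j * ℓ v x)))
             ≈⟨ sum-cong-≋ (λ v → trans (sum-cong-≋ (λ x →
                  solve 3 (λ a b c → a :* (b :* c) := b :* (a :* c)) refl (z x) (ε v j) (ℓ v x)))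
                  (sym (*-sum (ε v j) (λ x → z x * ℓ v x)))) ⟩
           sum (λ v → ε v j * sum (λ x → z x * ℓ v x)) ∎)) ⟩
    z j - sum (λ v → ε v j * sum (λ x → z x * ℓ v x)) ∎

  -- The potential at `v` is the integral of `z` along the chosen path from `root` to `v`. By
  -- `sum-basic`, vanishing on `basic j` says that `z j` is the difference of the potentials at the
  -- ends of `j`.
  annihilator : ∀ (z : Fin e → Carrier) → (∀ j → sum (λ x → z x * basic j x) ≈ 0#) →
                ∃ λ (φ : Fin n → Carrier) → ∀ j → z j ≈ sum (λ v → ε v j * φ v)
  annihilator z z⊥ = (λ v → sum (λ x → z x * ℓ v x)) , λ j → begin
    z j            ≈⟨ solve 2 (λ z c → z := (z :- c) :+ c) refl (z j) _ ⟩
    (z j - c j) + c j  ≈⟨ +-congʳ (trans (sym (sum-basic z j)) (z⊥ j)) ⟩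
    0# + c j       ≈⟨ +-identityˡ _ ⟩
    c j            ∎
    where c = λ j → sum (λ v → ε v j * sum (λ x → z x * ℓ v x))

  -- The edge `j` and the difference of the paths to its ends have the same boundary: the
  -- contributions at `root` cancel by `sum-ε`.
  basic-flow : ∀ j → IsFlow (basic j)
  basic-flow j v = begin
    sum (λ x → ε v x * basic j x)
      ≈⟨ sum-basic (ε v) j ⟩
    ε v j - sum (λ u → ε u j * ∂ (ℓ u) v)
      ≈⟨ +-congˡ (-‿cong (sum-cong-≋ (λ u → trans (*-congˡ (∂-chain (path u) v))
           (trans (*-congˡ (+-congʳ (δ-sym u v)))
           (solve 3 (λ a b c → a :* (b :- c) := b :* a :- a :* c) refl (ε u j) (δ v u) (δ root v)))))) ⟩
    ε v j - sum (λ u → δ v u * ε u j - ε u j * δ root v)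
      ≈⟨ +-congˡ (-‿cong (trans (sum-sub (λ u → δ v u * ε u j) (λ u → ε u j * δ root v))
           (+-cong (sum-δ v (λ u → ε u j))
                   (-‿cong (trans (sym (sum-* (δ root v) (λ u → ε u j)))
                                  (trans (*-congʳ (sum-ε j)) (zeroˡ _))))))) ⟩
    ε v j - (ε v j - 0#)
      ≈⟨ solve 1 (λ a → a :- (a :- :con (+ 0)) := :con (+ 0)) refl (ε v j) ⟩
    0# ∎

  -- The path corrections of `s` enter with the factors `∂ s v`, which vanish. So the basic flows
  -- span all flows, and no basis has to be selected.
  flow-expansion : ∀ {s} → IsFlow s → ∀ x → sum (λ j → s j * basic j x) ≈ s x
  flow-expansion {s} flow x = begin
    sum (λ j → s j * basic j x)
      ≈⟨ sum-cong-≋ (λ j → trans (*-congˡ (basic≈ j x))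
           (trans (*-congˡ (+-congʳ (δ-sym j x)))
           (solve 3 (λ z d s → z :* (d :- s) := d :* z :- z :* s) refl (s j) (δ x j) _))) ⟩
    sum (λ j → δ x j * s j - s j * sum (λ v → ε v j * ℓ v x))
      ≈⟨ sum-sub (λ j → δ x j * s j) _ ⟩
    sum (λ j → δ x j * s j) - sum (λ j → s j * sum (λ v → ε v j * ℓ v x))
      ≈⟨ +-cong (sum-δ x s) (-‿cong (begin
           sum (λ j → s j * sum (λ v → ε v j * ℓ v x))
             ≈⟨ sum-cong-≋ (λ j → *-sum (s j) (λ v → ε v j * ℓ v x)) ⟩
           sum (λ j → sum (λ v → s j * (ε v j * ℓ v x)))
             ≈⟨ sum-swap (λ j v → s j * (ε v j * ℓ v x)) ⟩
           sum (λ v → sum (λ j → s j * (ε v j * ℓ v x)))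
             ≈⟨ sum-cong-≋ (λ v → trans (sum-cong-≋ (λ j →
                  solve 3 (λ a b c → a :* (b :* c) := (b :* a) :* c) refl (s j) (ε v j) (ℓ v x)))
                  (sym (sum-* (ℓ v x) (λ j → ε v j * s j)))) ⟩
           sum (λ v → ∂ s v * ℓ v x)
             ≈⟨ sum-zero (λ v → trans (*-congʳ (flow v)) (zeroˡ _)) ⟩
           0# ∎)) ⟩
    s x - 0#
      ≈⟨ solve 1 (λ a → a :- :con (+ 0) := a) refl (s x) ⟩
    s x ∎

  combination-flow : ∀ {m} (c : Fin m → Carrier) (z : Fin m → Fin e → Carrier) →
                     (∀ j → IsFlow (z j)) → IsFlow (λ x → sum (λ j → c j * z j x))
  combination-flow c z flow v = begin
    sum (λ x → ε v x * sum (λ j → c j * z j x))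
      ≈⟨ sum-cong-≋ (λ x → *-sum (ε v x) (λ j → c j * z j x)) ⟩
    sum (λ x → sum (λ j → ε v x * (c j * z j x)))
      ≈⟨ sum-swap (λ x j → ε v x * (c j * z j x)) ⟩
    sum (λ j → ∂ (λ x → c j * z j x) v)
      ≈⟨ sum-zero (λ j → trans (∂-* (c j) (z j) v) (trans (*-congˡ (flow j v)) (zeroʳ _))) ⟩
    0# ∎

  record Star (v : Fin n) : Set where
    field
      e₁ e₂ e₃ : Fin e
      e₁≢e₂ : e₁ ≢ e₂
      e₁≢e₃ : e₁ ≢ e₃
      e₂≢e₃ : e₂ ≢ e₃
      inc₁ : Inc v e₁
      inc₂ : Inc v e₂
      inc₃ : Inc v e₃
      star-sum : ∀ f → (∀ x → ¬ Inc v x → f x ≈ 0#) → sum f ≈ f e₁ + f e₂ + f e₃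

  abstract
    star : ∀ v → Star v
    star v with supportList multiplicity multiplicity≤1
      where
      multiplicity : Fin e → ℕ
      multiplicity x = ind G (tail x) v ℕ.+ ind G (head x) v
      multiplicity≤1 : ∀ x → multiplicity x ≤ 1
      multiplicity≤1 x with tail x ≟ v | head x ≟ v
      ... | yes t≡v | yes h≡v = contradiction (≡.trans t≡v (≡.sym h≡v)) (loopless x)
      ... | yes _   | no _    = s≤s z≤n
      ... | no _    | yes _   = s≤s z≤n
      ... | no _    | no _    = z≤n
    ... | record { list = l ; length≡ = len ; unique = uniq ; member = mem ; sum≈ = sum≈ }
      with l | ≡.trans len (trivalent v) | uniq | mem
    ... | a ∷ b ∷ c ∷ [] | _ | (a≢b ∷ a≢c ∷ []) ∷ (b≢c ∷ []) ∷ _ | ma ∷ mb ∷ mc ∷ [] = record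
      { e₁ = a ; e₂ = b ; e₃ = c ; e₁≢e₂ = a≢b ; e₁≢e₃ = a≢c ; e₂≢e₃ = b≢c
      ; inc₁ = incident ma ; inc₂ = incident mb ; inc₃ = incident mc
      ; star-sum = λ f f≈0 → trans (sum≈ f (λ x d≡0 → f≈0 x (not-incident d≡0)))
          (solve 3 (λ a b c → a :+ (b :+ (c :+ :con (+ 0))) := a :+ b :+ c) refl (f a) (f b) (f c)) }
      where
      incident : ∀ {x} → ind G (tail x) v ℕ.+ ind G (head x) v ≢ 0 → Inc v x
      incident {x} d≢0 with tail x ≟ v | head x ≟ v
      ... | yes t≡v | _       = inj₁ t≡v
      ... | no _    | yes h≡v = inj₂ h≡v
      ... | no _    | no _    = contradiction ≡.refl d≢0
      not-incident : ∀ {x} → ind G (tail x) v ℕ.+ ind G (head x) v ≡ 0 → ¬ Inc v x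
      not-incident {x} d≡0 with tail x ≟ v | head x ≟ v
      ... | no t≢v | no h≢v = [ t≢v , h≢v ]′

  open module StarAt (v : Fin n) = Star (star v) public

  -- Otherwise `star-sum`, applied to the indicator of `x`, would give 1 = 0.
  inc-star : ∀ {v x} → Inc v x → x ≡ e₁ v ⊎ x ≡ e₂ v ⊎ x ≡ e₃ v
  inc-star {v} {x} inc with x ≟ e₁ v | x ≟ e₂ v | x ≟ e₃ v
  ... | yes p | _ | _ = inj₁ p
  ... | no _ | yes p | _ = inj₂ (inj₁ p)
  ... | no _ | no _ | yes p = inj₂ (inj₂ p)
  ... | no a | no b | no c = ⊥-elim (1≉0 (begin
    1#                                          ≈⟨ sym (sum-δ-1 x) ⟩
    sum (δ x)                                   ≈⟨ star-sum v (δ x) (λ y ¬inc → δ-≢ {a = x} {y} (λ x≡y → ¬inc (≡.subst (Inc v) x≡y inc))) ⟩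
    δ x (e₁ v) + δ x (e₂ v) + δ x (e₃ v)        ≈⟨ +-cong (+-cong (δ-≢ a) (δ-≢ b)) (δ-≢ c) ⟩
    0# + 0# + 0#                                ≈⟨ solve 0 (:con (+ 0) :+ :con (+ 0) :+ :con (+ 0) := :con (+ 0)) refl ⟩
    0#                                          ∎))

  -- The factor `- ε v x` orients `x` away from `v`, so that its boundary runs from `v` to `u`.
  otherEnd : ∀ {v x} → Inc v x → ∃ λ u → u ≢ v × (∀ y → ε y x * - ε v x ≈ δ u y - δ v y)
  otherEnd {v} {x} (inj₁ ≡.refl) = head x , (loopless x ∘ ≡.sym) , λ y →
    trans (*-congˡ (trans (-‿cong (ε-tail x)) (solve 1 (λ a → :- (:- a) := a) refl 1#))) (*-identityʳ _)
  otherEnd {v} {x} (inj₂ ≡.refl) = tail x , loopless x , λ y →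
    trans (*-congˡ (-‿cong (ε-head x)))
      (trans (solve 3 (λ h t o → (h :- t) :* :- o := (t :- h) :* o) refl (δ (head x) y) (δ (tail x) y) 1#)
             (*-identityʳ _))

  -- After deletion of `v` the far ends of `a` and `b` are still joined by a walk. Leaving `v` along
  -- `a` and returning along `b` closes it up, so `a` and `b` carry opposite signs relative to `v`
  -- and the third edge at `v` carries 0.
  module CycleThrough {v : Fin n} {a b : Fin e} (a≢b : a ≢ b) (inc-a : Inc v a) (inc-b : Inc v b) where
    u w : Fin n
    u = proj₁ (otherEnd inc-a)
    w = proj₁ (otherEnd inc-b)

    u≢v : u ≢ v
    u≢v = proj₁ (proj₂ (otherEnd inc-a))
    w≢v : w ≢ v
    w≢v = proj₁ (proj₂ (otherEnd inc-b))

    p : Walk G ⁅ v ⁆ u w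
    p = proj₂ (proj₂ connected) ⁅ v ⁆ (≡.subst (_≤ 2) (≡.sym (∣⁅x⁆∣≡1 v)) (s≤s z≤n)) u w
          (x≢y⇒x∉⁅y⁆ u≢v) (x≢y⇒x∉⁅y⁆ w≢v)

    s : Fin e → Carrier
    s x = ι (chain p x) + (- ε v a * δ a x + ε v b * δ b x)

    chain≈0 : ∀ {x} → Inc v x → ι (chain p x) ≈ 0#
    chain≈0 inc = reflexive (≡.cong ι (chain-avoids p (x≢y⇒x∉⁅y⁆ u≢v) (x∈⁅x⁆ v) inc))

    flow : IsFlow s
    flow y = begin
      ∂ s y
        ≈⟨ ∂-+ (ι ∘ chain p) _ y ⟩
      ∂ (ι ∘ chain p) y + ∂ (λ x → - ε v a * δ a x + ε v b * δ b x) y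
        ≈⟨ +-cong (∂-chain p y) (trans (∂-+ (λ x → - ε v a * δ a x) _ y)
             (+-cong (trans (∂-* (- ε v a) (δ a) y) (*-congˡ (∂-δ a y)))
                     (trans (∂-* (ε v b) (δ b) y) (*-congˡ (∂-δ b y))))) ⟩
      (δ w y - δ u y) + (- ε v a * ε y a + ε v b * ε y b)
        ≈⟨ solve 6 (λ w u a a′ b b′ → (w :- u) :+ (:- a :* a′ :+ b :* b′)
                                    := (w :- u) :+ (a′ :* :- a :- b′ :* :- b)) refl
             (δ w y) (δ u y) (ε v a) (ε y a) (ε v b) (ε y b) ⟩
      (δ w y - δ u y) + (ε y a * - ε v a - ε y b * - ε v b)
        ≈⟨ +-congˡ (+-cong (proj₂ (proj₂ (otherEnd inc-a)) y) (-‿cong (proj₂ (proj₂ (otherEnd inc-b)) y))) ⟩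
      (δ w y - δ u y) + ((δ u y - δ v y) - (δ w y - δ v y))
        ≈⟨ solve 3 (λ w u v → (w :- u) :+ ((u :- v) :- (w :- v)) := :con (+ 0)) refl (δ w y) (δ u y) (δ v y) ⟩
      0# ∎

    s-a : ¬ s a ≈ 0#
    s-a s≈0 = 1≉0 (begin
      1#                ≈⟨ sym (ε² inc-a) ⟩
      ε v a * ε v a     ≈⟨ *-congˡ (begin
        ε v a             ≈⟨ solve 1 (λ a → a := :- (:- a)) refl (ε v a) ⟩
        - - ε v a         ≈⟨ -‿cong (begin
          - ε v a                                   ≈⟨ sym (*-identityʳ _) ⟩
          - ε v a * 1#                              ≈⟨ *-congˡ (sym (δ-refl a)) ⟩
          - ε v a * δ a a                           ≈⟨ solve 2 (λ x c → x := :con (+ 0) :+ (x :+ c :* :con (+ 0))) refl _ (ε v b) ⟩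
          0# + (- ε v a * δ a a + ε v b * 0#)       ≈⟨ sym (+-cong (chain≈0 inc-a) (+-congˡ (*-congˡ (δ-≢ (a≢b ∘ ≡.sym))))) ⟩
          s a                                       ≈⟨ s≈0 ⟩
          0# ∎) ⟩
        - 0#              ≈⟨ solve 0 (:- :con (+ 0) := :con (+ 0)) refl ⟩
        0# ∎) ⟩
      ε v a * 0#        ≈⟨ zeroʳ _ ⟩
      0#                ∎)

    off : ∀ x → Inc v x → x ≢ a → x ≢ b → s x ≈ 0#
    off x inc x≢a x≢b = begin
      s x
        ≈⟨ +-cong (chain≈0 inc) (+-cong (*-congˡ (δ-≢ (x≢a ∘ ≡.sym))) (*-congˡ (δ-≢ (x≢b ∘ ≡.sym)))) ⟩
      0# + (- ε v a * 0# + ε v b * 0#)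
        ≈⟨ solve 2 (λ a b → :con (+ 0) :+ (:- a :* :con (+ 0) :+ b :* :con (+ 0)) := :con (+ 0)) refl (ε v a) (ε v b) ⟩
      0# ∎

  abstract
    cycleThrough : ∀ {v a b} → a ≢ b → Inc v a → Inc v b →
      ∃ λ s → IsFlow s × ¬ s a ≈ 0# × (∀ x → Inc v x → x ≢ a → x ≢ b → s x ≈ 0#)
    cycleThrough a≢b inc-a inc-b = s , flow , s-a , off
      where open CycleThrough a≢b inc-a inc-b

  abstract
    edge-in-flow : ∀ x → ∃ λ s → IsFlow s × ¬ s x ≈ 0#
    edge-in-flow x = [ (λ x≡e₁ → through (inc₂ v) (distinct x≡e₁ (e₁≢e₂ v)))
                     , [ (λ x≡e₂ → through (inc₁ v) (distinct x≡e₂ (e₁≢e₂ v ∘ ≡.sym)))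
                       , (λ x≡e₃ → through (inc₁ v) (distinct x≡e₃ (e₁≢e₃ v ∘ ≡.sym))) ]′ ]′
                     (inc-star {v} {x} (inj₁ ≡.refl))
      where
      v : Fin n
      v = tail x
      distinct : ∀ {y z} → x ≡ y → y ≢ z → x ≢ z
      distinct x≡y y≢z x≡z = y≢z (≡.trans (≡.sym x≡y) x≡z)
      through : ∀ {b} → Inc v b → x ≢ b → ∃ λ s → IsFlow s × ¬ s x ≈ 0#
      through inc-b x≢b =
        let s , flow , s≉0 , _ = cycleThrough x≢b (inj₁ ≡.refl) inc-b in s , flow , s≉0

-- The points of the hyperplane section and the diagonal form.

module Section (K : ACField) {n e : ℕ} (G : Graph n e)
               (trivalent : Trivalent G) (connected : ThreeConnected G) where
  open ACField K hiding (zero)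
  open Integers cring
  open Sums cring
  open Polynomials K using (*-≉0)
  open Solver using (solve; _:=_; _:+_; _:*_; _:-_; :-_) renaming (con to :con)
  open Flows K G trivalent connected
  open import Relation.Binary.Reasoning.Setoid setoid

  ε≉0 : ∀ {v x} → Inc v x → ¬ ε v x ≈ 0#
  ε≉0 inc ε≈0 = 1≉0 (trans (sym (ε² inc)) (trans (*-congʳ ε≈0) (zeroˡ _)))

  -- The value of `s` on `x` when `x` is oriented towards `v`; zero if `x` does not meet `v`.
  out : (Fin e → Carrier) → Fin n → Fin e → Carrier
  out s v x = ε v x * s x

  ∂-star : ∀ s v → ∂ s v ≈ out s v (e₁ v) + out s v (e₂ v) + out s v (e₃ v)
  ∂-star s v = star-sum v _ (λ x ¬inc → trans (*-congʳ (ε-off ¬inc)) (zeroˡ _))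

  sum-ε-* : ∀ x (f : Fin n → Carrier) → sum (λ v → ε v x * f v) ≈ f (head x) - f (tail x)
  sum-ε-* x f = begin
    sum (λ v → ε v x * f v)
      ≈⟨ sum-cong-≋ (λ v → solve 3 (λ h t f → (h :- t) :* f := h :* f :- t :* f) refl
                             (δ (head x) v) (δ (tail x) v) (f v)) ⟩
    sum (λ v → δ (head x) v * f v - δ (tail x) v * f v)
      ≈⟨ sum-sub (λ v → δ (head x) v * f v) (λ v → δ (tail x) v * f v) ⟩
    sum (λ v → δ (head x) v * f v) - sum (λ v → δ (tail x) v * f v)
      ≈⟨ +-cong (sum-δ (head x) f) (-‿cong (sum-δ (tail x) f)) ⟩
    f (head x) - f (tail x) ∎

  -- The linear form on flows that represents the point p_v = L_v ∩ H, for H given by the flow t.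
  coord : (Fin e → Carrier) → Fin n → Fin e → Carrier
  coord t v x = out t v (e₂ v) * (ε v (e₁ v) * δ (e₁ v) x) - out t v (e₁ v) * (ε v (e₂ v) * δ (e₂ v) x)

  point : (Fin e → Carrier) → Fin n → (Fin e → Carrier) → Carrier
  point t v s = sum (λ x → coord t v x * s x)

  point≈ : ∀ t v s → point t v s ≈ out t v (e₂ v) * out s v (e₁ v) - out t v (e₁ v) * out s v (e₂ v)
  point≈ t v s = begin
    sum (λ x → coord t v x * s x)
      ≈⟨ sum-cong-≋ (λ x → solve 7 (λ t₂ ε₁ d₁ t₁ ε₂ d₂ s →
             (t₂ :* (ε₁ :* d₁) :- t₁ :* (ε₂ :* d₂)) :* s :=
             d₁ :* (t₂ :* (ε₁ :* s)) :- d₂ :* (t₁ :* (ε₂ :* s))) refl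
           (out t v (e₂ v)) (ε v (e₁ v)) (δ (e₁ v) x) (out t v (e₁ v)) (ε v (e₂ v)) (δ (e₂ v) x) (s x)) ⟩
    sum (λ x → δ (e₁ v) x * (out t v (e₂ v) * (ε v (e₁ v) * s x))
             - δ (e₂ v) x * (out t v (e₁ v) * (ε v (e₂ v) * s x)))
      ≈⟨ sum-sub (λ x → δ (e₁ v) x * (out t v (e₂ v) * (ε v (e₁ v) * s x))) _ ⟩
    _ ≈⟨ +-cong (sum-δ (e₁ v) (λ x → out t v (e₂ v) * (ε v (e₁ v) * s x)))
                (-‿cong (sum-δ (e₂ v) (λ x → out t v (e₁ v) * (ε v (e₂ v) * s x)))) ⟩
    out t v (e₂ v) * out s v (e₁ v) - out t v (e₁ v) * out s v (e₂ v) ∎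

  point-out-cong : ∀ t v {s s′} → (∀ x → out s v x ≈ out s′ v x) → point t v s ≈ point t v s′
  point-out-cong t v {s} {s′} eq = begin
    point t v s   ≈⟨ point≈ t v s ⟩
    _             ≈⟨ +-cong (*-congˡ (eq (e₁ v))) (-‿cong (*-congˡ (eq (e₂ v)))) ⟩
    _             ≈⟨ sym (point≈ t v s′) ⟩
    point t v s′  ∎

  point-cong : ∀ t v {s s′} → (∀ x → s x ≈ s′ x) → point t v s ≈ point t v s′
  point-cong t v eq = sum-cong-≋ (λ x → *-congˡ (eq x))

  sum-combination : ∀ {k m} (a : Fin m → Carrier) (c : Fin k → Carrier) (z : Fin k → Fin m → Carrier) →
    sum (λ x → a x * sum (λ j → c j * z j x)) ≈ sum (λ j → c j * sum (λ x → a x * z j x))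
  sum-combination a c z = begin
    sum (λ x → a x * sum (λ j → c j * z j x))
      ≈⟨ sum-cong-≋ (λ x → *-sum (a x) (λ j → c j * z j x)) ⟩
    sum (λ x → sum (λ j → a x * (c j * z j x)))
      ≈⟨ sum-swap (λ x j → a x * (c j * z j x)) ⟩
    sum (λ j → sum (λ x → a x * (c j * z j x)))
      ≈⟨ sum-cong-≋ (λ j → trans
           (sum-cong-≋ (λ x → solve 3 (λ a c z → a :* (c :* z) := c :* (a :* z)) refl (a x) (c j) (z j x)))
           (sym (*-sum (c j) (λ x → a x * z j x)))) ⟩
    sum (λ j → c j * sum (λ x → a x * z j x)) ∎

  relation-flow : ∀ t (c : Fin n → Carrier) → (∀ j → sum (λ v → c v * point t v (basic j)) ≈ 0#) →
                  ∀ {s} → IsFlow s → sum (λ v → c v * point t v s) ≈ 0#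
  relation-flow t c rel {s} flow = begin
    sum (λ v → c v * point t v s)
      ≈⟨ sum-cong-≋ (λ v → *-congˡ (trans (point-cong t v (λ x → sym (flow-expansion flow x)))
                                          (sum-combination (coord t v) s basic))) ⟩
    sum (λ v → c v * sum (λ j → s j * point t v (basic j)))
      ≈⟨ sum-combination c s (λ j v → point t v (basic j)) ⟩
    sum (λ j → s j * sum (λ v → c v * point t v (basic j)))
      ≈⟨ sum-zero (λ j → trans (*-congˡ (rel j)) (zeroʳ _)) ⟩
    0# ∎

  module _ (S₁ S₂ S₃ S₁′ S₂′ S₃′ T₁ T₂ T₃ U₁ U₂ U₃ : Carrier)
           (S≈0 : S₁ + S₂ + S₃ ≈ 0#) (S′≈0 : S₁′ + S₂′ + S₃′ ≈ 0#) (T≈0 : T₁ + T₂ + T₃ ≈ 0#)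
           (TU₁ : T₁ * U₁ ≈ 1#) (TU₂ : T₂ * U₂ ≈ 1#) (TU₃ : T₃ * U₃ ≈ 1#) where
    private
      third : ∀ {a b c} → a + b + c ≈ 0# → c ≈ - (a + b)
      third {a} {b} {c} eq = begin
        c                      ≈⟨ solve 3 (λ a b c → c := (a :+ b :+ c) :- (a :+ b)) refl a b c ⟩
        (a + b + c) - (a + b)  ≈⟨ +-congʳ eq ⟩
        0# - (a + b)           ≈⟨ +-identityˡ _ ⟩
        - (a + b)              ∎

      insert : ∀ {a b} x → a ≈ 1# → b ≈ 1# → x ≈ (a * b) * x
      insert x a≈1 b≈1 = sym (trans (*-congʳ (trans (*-cong a≈1 b≈1) (*-identityˡ 1#))) (*-identityˡ x))

    -- This is the identity (T₂S₁ - T₁S₂)(T₂S₁′ - T₁S₂′) = -(T₂T₃S₁S₁′ + T₁T₃S₂S₂′ + T₁T₂S₃S₃′)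
    -- divided by T₁T₂T₃. It becomes a polynomial identity once the third coordinates are
    -- eliminated.
    local-form : (U₁ * U₂ * U₃) * ((T₂ * S₁ - T₁ * S₂) * (T₂ * S₁′ - T₁ * S₂′))
               ≈ - (U₁ * (S₁ * S₁′) + U₂ * (S₂ * S₂′) + U₃ * (S₃ * S₃′))
    local-form = begin
      (U₁ * U₂ * U₃) * ((T₂ * S₁ - T₁ * S₂) * (T₂ * S₁′ - T₁ * S₂′))
        ≈⟨ solve 9 (λ s₁ s₂ s₁′ s₂′ t₁ t₂ u₁ u₂ u₃ →
             (u₁ :* u₂ :* u₃) :* ((t₂ :* s₁ :- t₁ :* s₂) :* (t₂ :* s₁′ :- t₁ :* s₂′)) :=
             :- (u₁ :* u₂ :* u₃ :* (t₂ :* (:- (t₁ :+ t₂)) :* (s₁ :* s₁′)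
                                   :+ t₁ :* (:- (t₁ :+ t₂)) :* (s₂ :* s₂′)
                                   :+ t₁ :* t₂ :* ((:- (s₁ :+ s₂)) :* (:- (s₁′ :+ s₂′)))))) refl
             S₁ S₂ S₁′ S₂′ T₁ T₂ U₁ U₂ U₃ ⟩
      - (U₁ * U₂ * U₃ * (T₂ * - (T₁ + T₂) * (S₁ * S₁′) + T₁ * - (T₁ + T₂) * (S₂ * S₂′)
                        + T₁ * T₂ * (- (S₁ + S₂) * - (S₁′ + S₂′))))
        ≈⟨ -‿cong (*-congˡ (sym (+-cong (+-cong (*-congʳ (*-congˡ (third T≈0))) (*-congʳ (*-congˡ (third T≈0))))
                                        (*-congˡ (*-cong (third S≈0) (third S′≈0)))))) ⟩
      - (U₁ * U₂ * U₃ * (T₂ * T₃ * (S₁ * S₁′) + T₁ * T₃ * (S₂ * S₂′) + T₁ * T₂ * (S₃ * S₃′)))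
        ≈⟨ solve 9 (λ u₁ u₂ u₃ t₁ t₂ t₃ a b c →
             :- (u₁ :* u₂ :* u₃ :* (t₂ :* t₃ :* a :+ t₁ :* t₃ :* b :+ t₁ :* t₂ :* c)) :=
             :- ((t₂ :* u₂) :* (t₃ :* u₃) :* (u₁ :* a) :+ (t₁ :* u₁) :* (t₃ :* u₃) :* (u₂ :* b)
                 :+ (t₁ :* u₁) :* (t₂ :* u₂) :* (u₃ :* c))) refl
             U₁ U₂ U₃ T₁ T₂ T₃ (S₁ * S₁′) (S₂ * S₂′) (S₃ * S₃′) ⟩
      - ((T₂ * U₂) * (T₃ * U₃) * (U₁ * (S₁ * S₁′)) + (T₁ * U₁) * (T₃ * U₃) * (U₂ * (S₂ * S₂′))
         + (T₁ * U₁) * (T₂ * U₂) * (U₃ * (S₃ * S₃′)))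
        ≈⟨ -‿cong (sym (+-cong (+-cong (insert _ TU₂ TU₃) (insert _ TU₁ TU₃)) (insert _ TU₁ TU₂))) ⟩
      - (U₁ * (S₁ * S₁′) + U₂ * (S₂ * S₂′) + U₃ * (S₃ * S₃′)) ∎

  module _ (A₁ A₂ A₃ T₁ T₂ T₃ U₂ : Carrier) (T≈0 : T₁ + T₂ + T₃ ≈ 0#) (TU₂ : T₂ * U₂ ≈ 1#)
           (AT≈0 : A₁ * T₁ + A₂ * T₂ + A₃ * T₃ ≈ 0#) where
    -- Subtracting `A₃ * (S₁ + S₂ + S₃)` leaves a form in `S₁` and `S₂` that vanishes at `T₁`, `T₂`,
    -- hence a multiple of `T₂ * S₁ - T₁ * S₂`. The coefficient of `S₁` gives the factor.
    local-multiple : ∀ S₁ S₂ S₃ → S₁ + S₂ + S₃ ≈ 0# →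
      A₁ * S₁ + A₂ * S₂ + A₃ * S₃ ≈ ((A₁ - A₃) * U₂) * (T₂ * S₁ - T₁ * S₂)
    local-multiple S₁ S₂ S₃ S≈0 = begin
      A₁ * S₁ + A₂ * S₂ + A₃ * S₃
        ≈⟨ solve 6 (λ a₁ a₂ a₃ s₁ s₂ s₃ → a₁ :* s₁ :+ a₂ :* s₂ :+ a₃ :* s₃ :=
             (a₁ :- a₃) :* s₁ :+ (a₂ :- a₃) :* s₂ :+ a₃ :* (s₁ :+ s₂ :+ s₃)) refl A₁ A₂ A₃ S₁ S₂ S₃ ⟩
      (A₁ - A₃) * S₁ + (A₂ - A₃) * S₂ + A₃ * (S₁ + S₂ + S₃)
        ≈⟨ +-congˡ (trans (*-congˡ S≈0) (zeroʳ _)) ⟩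
      (A₁ - A₃) * S₁ + (A₂ - A₃) * S₂ + 0#
        ≈⟨ +-congʳ (+-cong (one ((A₁ - A₃) * S₁)) (one ((A₂ - A₃) * S₂))) ⟩
      (T₂ * U₂) * ((A₁ - A₃) * S₁) + (T₂ * U₂) * ((A₂ - A₃) * S₂) + 0#
        ≈⟨ solve 9 (λ a₁ a₂ a₃ t₁ t₂ t₃ u s₁ s₂ →
             (t₂ :* u) :* ((a₁ :- a₃) :* s₁) :+ (t₂ :* u) :* ((a₂ :- a₃) :* s₂) :+ :con (+ 0) :=
             ((a₁ :- a₃) :* u) :* (t₂ :* s₁ :- t₁ :* s₂)
             :+ u :* s₂ :* ((a₁ :* t₁ :+ a₂ :* t₂ :+ a₃ :* t₃) :- a₃ :* (t₁ :+ t₂ :+ t₃))) refl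
             A₁ A₂ A₃ T₁ T₂ T₃ U₂ S₁ S₂ ⟩
      ((A₁ - A₃) * U₂) * (T₂ * S₁ - T₁ * S₂)
        + U₂ * S₂ * ((A₁ * T₁ + A₂ * T₂ + A₃ * T₃) - A₃ * (T₁ + T₂ + T₃))
        ≈⟨ +-congˡ (*-congˡ (+-cong AT≈0 (-‿cong (*-congˡ T≈0)))) ⟩
      ((A₁ - A₃) * U₂) * (T₂ * S₁ - T₁ * S₂) + U₂ * S₂ * (0# - A₃ * 0#)
        ≈⟨ solve 3 (λ x y a → x :+ y :* (:con (+ 0) :- a :* :con (+ 0)) := x) refl _ (U₂ * S₂) A₃ ⟩
      ((A₁ - A₃) * U₂) * (T₂ * S₁ - T₁ * S₂) ∎
      where
      one : ∀ x → x ≈ (T₂ * U₂) * x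
      one x = sym (trans (*-congʳ TU₂) (*-identityˡ x))

  module Hyperplane (t : Fin e → Carrier) (t-flow : IsFlow t) (t≉0 : ∀ x → ¬ t x ≈ 0#) where

    t⁻¹ : Fin e → Carrier
    t⁻¹ x = proj₁ (inverse (t x) (t≉0 x))

    out-inverse : ∀ {v x} → Inc v x → out t v x * out t⁻¹ v x ≈ 1#
    out-inverse {v} {x} inc = begin
      (ε v x * t x) * (ε v x * t⁻¹ x)
        ≈⟨ solve 3 (λ e t u → (e :* t) :* (e :* u) := (e :* e) :* (t :* u)) refl (ε v x) (t x) (t⁻¹ x) ⟩
      (ε v x * ε v x) * (t x * t⁻¹ x)
        ≈⟨ *-cong (ε² inc) (proj₂ (inverse (t x) (t≉0 x))) ⟩
      1# * 1#
        ≈⟨ *-identityˡ 1# ⟩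
      1# ∎

    weight : Fin n → Carrier
    weight v = out t⁻¹ v (e₁ v) * out t⁻¹ v (e₂ v) * out t⁻¹ v (e₃ v)

    weight⁻¹ : Fin n → Carrier
    weight⁻¹ v = out t v (e₁ v) * out t v (e₂ v) * out t v (e₃ v)

    weight-inverse : ∀ v → weight v * weight⁻¹ v ≈ 1#
    weight-inverse v = begin
      weight v * weight⁻¹ v
        ≈⟨ solve 6 (λ u₁ u₂ u₃ t₁ t₂ t₃ → (u₁ :* u₂ :* u₃) :* (t₁ :* t₂ :* t₃) :=
             (t₁ :* u₁) :* (t₂ :* u₂) :* (t₃ :* u₃)) refl
             (out t⁻¹ v (e₁ v)) (out t⁻¹ v (e₂ v)) (out t⁻¹ v (e₃ v))
             (out t v (e₁ v)) (out t v (e₂ v)) (out t v (e₃ v)) ⟩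
      _ ≈⟨ *-cong (*-cong (out-inverse (inc₁ v)) (out-inverse (inc₂ v))) (out-inverse (inc₃ v)) ⟩
      1# * 1# * 1#
        ≈⟨ trans (*-congʳ (*-identityˡ 1#)) (*-identityˡ 1#) ⟩
      1# ∎

    weight≉0 : ∀ v → ¬ weight v ≈ 0#
    weight≉0 v w≈0 = 1≉0 (trans (sym (weight-inverse v)) (trans (*-congʳ w≈0) (zeroˡ _)))

    -- The sign `ε v x` enters three times, through `s`, `s′` and `t⁻¹`, and its cube is itself.
    -- This odd power makes the two ends of an edge cancel in `isotropic`.
    weighted-square : ∀ v s s′ → ∂ s v ≈ 0# → ∂ s′ v ≈ 0# →
      weight v * (point t v s * point t v s′) ≈ - sum (λ x → ε v x * (s x * s′ x * t⁻¹ x))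
    weighted-square v s s′ ∂s ∂s′ = begin
      weight v * (point t v s * point t v s′)
        ≈⟨ *-congˡ (*-cong (point≈ t v s) (point≈ t v s′)) ⟩
      _ ≈⟨ local-form (out s v (e₁ v)) (out s v (e₂ v)) (out s v (e₃ v))
                      (out s′ v (e₁ v)) (out s′ v (e₂ v)) (out s′ v (e₃ v))
                      (out t v (e₁ v)) (out t v (e₂ v)) (out t v (e₃ v))
                      (out t⁻¹ v (e₁ v)) (out t⁻¹ v (e₂ v)) (out t⁻¹ v (e₃ v))
                      (trans (sym (∂-star s v)) ∂s) (trans (sym (∂-star s′ v)) ∂s′)
                      (trans (sym (∂-star t v)) (t-flow v))
                      (out-inverse (inc₁ v)) (out-inverse (inc₂ v)) (out-inverse (inc₃ v)) ⟩
      - (out t⁻¹ v (e₁ v) * (out s v (e₁ v) * out s′ v (e₁ v))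
         + out t⁻¹ v (e₂ v) * (out s v (e₂ v) * out s′ v (e₂ v))
         + out t⁻¹ v (e₃ v) * (out s v (e₃ v) * out s′ v (e₃ v)))
        ≈⟨ -‿cong (+-cong (+-cong (edge (inc₁ v)) (edge (inc₂ v))) (edge (inc₃ v))) ⟩
      _ ≈⟨ -‿cong (sym (star-sum v (λ x → ε v x * (s x * s′ x * t⁻¹ x))
                         (λ x ¬inc → trans (*-congʳ (ε-off ¬inc)) (zeroˡ _)))) ⟩
      - sum (λ x → ε v x * (s x * s′ x * t⁻¹ x)) ∎
      where
      edge : ∀ {x} → Inc v x → out t⁻¹ v x * (out s v x * out s′ v x) ≈ ε v x * (s x * s′ x * t⁻¹ x)
      edge {x} inc = begin
        out t⁻¹ v x * (out s v x * out s′ v x)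
          ≈⟨ solve 4 (λ e s s′ u → (e :* u) :* ((e :* s) :* (e :* s′)) := (e :* e) :* (e :* (s :* s′ :* u)))
               refl (ε v x) (s x) (s′ x) (t⁻¹ x) ⟩
        (ε v x * ε v x) * (ε v x * (s x * s′ x * t⁻¹ x))
          ≈⟨ trans (*-congʳ (ε² inc)) (*-identityˡ _) ⟩
        ε v x * (s x * s′ x * t⁻¹ x) ∎

    -- An edge contributes with opposite signs at its two ends.
    isotropic : ∀ {s s′} → IsFlow s → IsFlow s′ →
                sum (λ v → weight v * (point t v s * point t v s′)) ≈ 0#
    isotropic {s} {s′} flow flow′ = begin
      sum (λ v → weight v * (point t v s * point t v s′))
        ≈⟨ sum-cong-≋ (λ v → weighted-square v s s′ (flow v) (flow′ v)) ⟩
      sum (λ v → - sum (λ x → ε v x * (s x * s′ x * t⁻¹ x)))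
        ≈⟨ sum-neg (λ v → sum (λ x → ε v x * (s x * s′ x * t⁻¹ x))) ⟩
      - sum (λ v → sum (λ x → ε v x * (s x * s′ x * t⁻¹ x)))
        ≈⟨ -‿cong (sum-swap (λ v x → ε v x * (s x * s′ x * t⁻¹ x))) ⟩
      - sum (λ x → sum (λ v → ε v x * (s x * s′ x * t⁻¹ x)))
        ≈⟨ -‿cong (sum-zero (λ x → trans (sum-ε-* x (λ _ → s x * s′ x * t⁻¹ x)) (-‿inverseʳ _))) ⟩
      - 0#
        ≈⟨ solve 0 (:- :con (+ 0) := :con (+ 0)) refl ⟩
      0# ∎

    module Coisotropic (c : Fin n → Carrier)
                       (rel : ∀ j → sum (λ v → c v * point t v (basic j)) ≈ 0#) where
      -- With values β, -β, 0 on the three edges, the point takes the value (t₁ + t₂) β = - t₃ β;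
      -- this `β` makes it `weight⁻¹ v * c v`.
      β : Fin n → Carrier
      β v = - (weight⁻¹ v * c v * out t⁻¹ v (e₃ v))

      σ : Fin n → Fin e → Carrier
      σ v x = β v * (ε v (e₁ v) * δ (e₁ v) x - ε v (e₂ v) * δ (e₂ v) x)

      out-σ : ∀ v {x d₁ d₂} → δ (e₁ v) x ≈ d₁ → δ (e₂ v) x ≈ d₂ →
              out (σ v) v x ≈ ε v x * (β v * (ε v (e₁ v) * d₁ - ε v (e₂ v) * d₂))
      out-σ v eq₁ eq₂ = *-congˡ (*-congˡ (+-cong (*-congˡ eq₁) (-‿cong (*-congˡ eq₂))))

      out-σ₁ : ∀ v → out (σ v) v (e₁ v) ≈ β v
      out-σ₁ v = begin
        out (σ v) v (e₁ v)
          ≈⟨ out-σ v (δ-refl (e₁ v)) (δ-≢ (e₁≢e₂ v ∘ ≡.sym)) ⟩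
        ε v (e₁ v) * (β v * (ε v (e₁ v) * 1# - ε v (e₂ v) * 0#))
          ≈⟨ solve 4 (λ e b f o → e :* (b :* (e :* o :- f :* :con (+ 0))) := (e :* e) :* (b :* o)) refl
               (ε v (e₁ v)) (β v) (ε v (e₂ v)) 1# ⟩
        (ε v (e₁ v) * ε v (e₁ v)) * (β v * 1#)
          ≈⟨ trans (*-cong (ε² (inc₁ v)) (*-identityʳ _)) (*-identityˡ _) ⟩
        β v ∎

      out-σ₂ : ∀ v → out (σ v) v (e₂ v) ≈ - β v
      out-σ₂ v = begin
        out (σ v) v (e₂ v)
          ≈⟨ out-σ v (δ-≢ (e₁≢e₂ v)) (δ-refl (e₂ v)) ⟩
        ε v (e₂ v) * (β v * (ε v (e₁ v) * 0# - ε v (e₂ v) * 1#))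
          ≈⟨ solve 4 (λ e b f o → e :* (b :* (f :* :con (+ 0) :- e :* o)) := (e :* e) :* (:- b :* o)) refl
               (ε v (e₂ v)) (β v) (ε v (e₁ v)) 1# ⟩
        (ε v (e₂ v) * ε v (e₂ v)) * (- β v * 1#)
          ≈⟨ trans (*-cong (ε² (inc₂ v)) (*-identityʳ _)) (*-identityˡ _) ⟩
        - β v ∎

      out-σ₃ : ∀ v → out (σ v) v (e₃ v) ≈ 0#
      out-σ₃ v = trans (out-σ v (δ-≢ (e₁≢e₃ v)) (δ-≢ (e₂≢e₃ v)))
        (solve 4 (λ e b f f′ → e :* (b :* (f :* :con (+ 0) :- f′ :* :con (+ 0))) := :con (+ 0)) refl
           (ε v (e₃ v)) (β v) (ε v (e₁ v)) (ε v (e₂ v)))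

      ∂σ : ∀ v → ∂ (σ v) v ≈ 0#
      ∂σ v = begin
        ∂ (σ v) v          ≈⟨ ∂-star (σ v) v ⟩
        _                  ≈⟨ +-cong (+-cong (out-σ₁ v) (out-σ₂ v)) (out-σ₃ v) ⟩
        β v - β v + 0#     ≈⟨ solve 1 (λ b → b :- b :+ :con (+ 0) := :con (+ 0)) refl (β v) ⟩
        0#                 ∎

      weight-σ : ∀ v → weight v * point t v (σ v) ≈ c v
      weight-σ v = begin
        weight v * point t v (σ v)
          ≈⟨ *-congˡ (trans (point≈ t v (σ v))
               (+-cong (*-congˡ (out-σ₁ v)) (-‿cong (*-congˡ (out-σ₂ v))))) ⟩
        weight v * (T₂ * β v - T₁ * - β v)
          ≈⟨ solve 5 (λ w y t₁ t₂ u → w :* (t₂ :* (:- (y :* u)) :- t₁ :* (:- (:- (y :* u))))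
                      := :- (t₁ :+ t₂) :* (w :* y :* u)) refl
               (weight v) (weight⁻¹ v * c v) T₁ T₂ U₃ ⟩
        - (T₁ + T₂) * (weight v * (weight⁻¹ v * c v) * U₃)
          ≈⟨ *-congʳ (begin
               - (T₁ + T₂)                    ≈⟨ solve 3 (λ a b c → :- (a :+ b) := c :- (a :+ b :+ c)) refl T₁ T₂ T₃ ⟩
               T₃ - (T₁ + T₂ + T₃)            ≈⟨ +-congˡ (-‿cong (trans (sym (∂-star t v)) (t-flow v))) ⟩
               T₃ - 0#                        ≈⟨ solve 1 (λ a → a :- :con (+ 0) := a) refl T₃ ⟩
               T₃                             ∎) ⟩
        T₃ * (weight v * (weight⁻¹ v * c v) * U₃)
          ≈⟨ solve 5 (λ t w w′ c u → t :* (w :* (w′ :* c) :* u) := (t :* u) :* (w :* w′) :* c) refl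
               T₃ (weight v) (weight⁻¹ v) (c v) U₃ ⟩
        (T₃ * U₃) * (weight v * weight⁻¹ v) * c v
          ≈⟨ *-congʳ (trans (*-cong (out-inverse (inc₃ v)) (weight-inverse v)) (*-identityˡ 1#)) ⟩
        1# * c v
          ≈⟨ *-identityˡ _ ⟩
        c v ∎
        where
        T₁ = out t v (e₁ v)
        T₂ = out t v (e₂ v)
        T₃ = out t v (e₃ v)
        U₃ = out t⁻¹ v (e₃ v)

      -- By `sum-ε-*` this is the difference of the local flows at the two ends of `x`, the
      -- obstruction to gluing them.
      jump : Fin e → Carrier
      jump x = sum (λ v → ε v x * σ v x)

      -- Polarizing with `σ v` and a basic flow in `weighted-square` turns the relation `rel` into
      -- this pairing. Hence `jump` divided by `t` is a coboundary.
      jump-annihilates : ∀ j → sum (λ x → (jump x * t⁻¹ x) * basic j x) ≈ 0#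
      jump-annihilates j = begin
        sum (λ x → (jump x * t⁻¹ x) * basic j x)
          ≈⟨ sum-cong-≋ (λ x → trans (*-assoc _ _ _) (trans (sum-* (t⁻¹ x * basic j x) (λ v → ε v x * σ v x))
               (sum-cong-≋ (λ v → solve 4 (λ e s u b → (e :* s) :* (u :* b) := e :* (s :* b :* u)) refl
                  (ε v x) (σ v x) (t⁻¹ x) (basic j x))))) ⟩
        sum (λ x → sum (λ v → ε v x * (σ v x * basic j x * t⁻¹ x)))
          ≈⟨ sum-swap (λ x v → ε v x * (σ v x * basic j x * t⁻¹ x)) ⟩
        sum (λ v → sum (λ x → ε v x * (σ v x * basic j x * t⁻¹ x)))
          ≈⟨ sum-cong-≋ (λ v → begin
               sum (λ x → ε v x * (σ v x * basic j x * t⁻¹ x))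
                 ≈⟨ solve 1 (λ a → a := :- (:- a)) refl _ ⟩
               - (- sum (λ x → ε v x * (σ v x * basic j x * t⁻¹ x)))
                 ≈⟨ -‿cong (sym (weighted-square v (σ v) (basic j) (∂σ v) (basic-flow j v))) ⟩
               - (weight v * (point t v (σ v) * point t v (basic j)))
                 ≈⟨ -‿cong (trans (sym (*-assoc _ _ _)) (*-congʳ (weight-σ v))) ⟩
               - (c v * point t v (basic j)) ∎) ⟩
        sum (λ v → - (c v * point t v (basic j)))
          ≈⟨ sum-neg (λ v → c v * point t v (basic j)) ⟩
        - sum (λ v → c v * point t v (basic j))
          ≈⟨ -‿cong (rel j) ⟩
        - 0#
          ≈⟨ solve 0 (:- :con (+ 0) := :con (+ 0)) refl ⟩
        0# ∎

      φ : Fin n → Carrier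
      φ = proj₁ (annihilator (λ x → jump x * t⁻¹ x) jump-annihilates)

      jump≈ : ∀ x → t x * sum (λ v → ε v x * φ v) ≈ jump x
      jump≈ x = begin
        t x * sum (λ v → ε v x * φ v)
          ≈⟨ *-congˡ (sym (proj₂ (annihilator (λ x → jump x * t⁻¹ x) jump-annihilates) x)) ⟩
        t x * (jump x * t⁻¹ x)
          ≈⟨ solve 3 (λ t z u → t :* (z :* u) := (t :* u) :* z) refl (t x) (jump x) (t⁻¹ x) ⟩
        (t x * t⁻¹ x) * jump x
          ≈⟨ trans (*-congʳ (proj₂ (inverse (t x) (t≉0 x)))) (*-identityˡ _) ⟩
        jump x ∎

      -- The forms σ v only matter up to multiples of t, and this freedom makes them agree on edges.
      σ′ : Fin n → Fin e → Carrier
      σ′ v x = σ v x - φ v * t x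

      agree : ∀ x → σ′ (head x) x ≈ σ′ (tail x) x
      agree x = begin
        σ′ (head x) x
          ≈⟨ solve 2 (λ a b → a := (a :- b) :+ b) refl _ (σ′ (tail x) x) ⟩
        (σ′ (head x) x - σ′ (tail x) x) + σ′ (tail x) x
          ≈⟨ +-congʳ (begin
               σ′ (head x) x - σ′ (tail x) x
                 ≈⟨ sym (sum-ε-* x (λ v → σ′ v x)) ⟩
               sum (λ v → ε v x * σ′ v x)
                 ≈⟨ sum-cong-≋ (λ v → solve 4 (λ e s p t → e :* (s :- p :* t) := e :* s :- t :* (e :* p)) refl
                      (ε v x) (σ v x) (φ v) (t x)) ⟩
               sum (λ v → ε v x * σ v x - t x * (ε v x * φ v))
                 ≈⟨ sum-sub (λ v → ε v x * σ v x) _ ⟩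
               jump x - sum (λ v → t x * (ε v x * φ v))
                 ≈⟨ +-congˡ (-‿cong (trans (sym (*-sum (t x) (λ v → ε v x * φ v))) (jump≈ x))) ⟩
               jump x - jump x
                 ≈⟨ -‿inverseʳ _ ⟩
               0# ∎) ⟩
        0# + σ′ (tail x) x
          ≈⟨ +-identityˡ _ ⟩
        σ′ (tail x) x ∎

      glued : Fin e → Carrier
      glued x = σ′ (head x) x

      out-glued : ∀ v x → out glued v x ≈ out (σ′ v) v x
      out-glued v x with head x ≟ v | tail x ≟ v
      ... | yes ≡.refl | _        = refl
      ... | no _ | yes ≡.refl     = *-congˡ (agree x)
      ... | no _ | no _           = trans (trans (*-congʳ (-‿inverseʳ 0#)) (zeroˡ _))
                                          (sym (trans (*-congʳ (-‿inverseʳ 0#)) (zeroˡ _)))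

      glued-flow : IsFlow glued
      glued-flow v = begin
        ∂ glued v
          ≈⟨ sum-cong-≋ (out-glued v) ⟩
        ∂ (σ′ v) v
          ≈⟨ sum-cong-≋ (λ x → solve 4 (λ e s p t → e :* (s :- p :* t) := e :* s :- p :* (e :* t)) refl
               (ε v x) (σ v x) (φ v) (t x)) ⟩
        sum (λ x → ε v x * σ v x - φ v * (ε v x * t x))
          ≈⟨ sum-sub (λ x → ε v x * σ v x) _ ⟩
        ∂ (σ v) v - sum (λ x → φ v * (ε v x * t x))
          ≈⟨ +-cong (∂σ v) (-‿cong (trans (sym (*-sum (φ v) (λ x → ε v x * t x)))
                                          (trans (*-congˡ (t-flow v)) (zeroʳ _)))) ⟩
        0# - 0#
          ≈⟨ -‿inverseʳ 0# ⟩
        0# ∎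

      -- `point t v` kills `t`, so the correction by `φ v * t` does not change its value.
      glued-weight : ∀ v → weight v * point t v glued ≈ c v
      glued-weight v = begin
        weight v * point t v glued
          ≈⟨ *-congˡ (begin
               point t v glued
                 ≈⟨ point-out-cong t v (out-glued v) ⟩
               point t v (σ′ v)
                 ≈⟨ point≈ t v (σ′ v) ⟩
               out t v (e₂ v) * out (σ′ v) v (e₁ v) - out t v (e₁ v) * out (σ′ v) v (e₂ v)
                 ≈⟨ solve 7 (λ ε₁ ε₂ t₁ t₂ s₁ s₂ p →
                      (ε₂ :* t₂) :* (ε₁ :* (s₁ :- p :* t₁)) :- (ε₁ :* t₁) :* (ε₂ :* (s₂ :- p :* t₂)) :=
                      (ε₂ :* t₂) :* (ε₁ :* s₁) :- (ε₁ :* t₁) :* (ε₂ :* s₂)) refl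
                      (ε v (e₁ v)) (ε v (e₂ v)) (t (e₁ v)) (t (e₂ v)) (σ v (e₁ v)) (σ v (e₂ v)) (φ v) ⟩
               out t v (e₂ v) * out (σ v) v (e₁ v) - out t v (e₁ v) * out (σ v) v (e₂ v)
                 ≈⟨ sym (point≈ t v (σ v)) ⟩
               point t v (σ v) ∎) ⟩
        weight v * point t v (σ v)
          ≈⟨ weight-σ v ⟩
        c v ∎

    abstract
      coisotropic : ∀ (c : Fin n → Carrier) → (∀ j → sum (λ v → c v * point t v (basic j)) ≈ 0#) →
                    ∃ λ s → IsFlow s × (∀ v → weight v * point t v s ≈ c v)
      coisotropic c rel = glued , glued-flow , glued-weight
        where open Coisotropic c rel

    -- On a cycle through `e₁` and `e₃` the value on `e₂` is 0, so the point reduces to t₂ s₁.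
    point-nonzero : ∀ v → ∃ λ s → IsFlow s × ¬ point t v s ≈ 0#
    point-nonzero v =
      let s , flow , s₁≉0 , s≈0 = cycleThrough (e₁≢e₃ v) (inc₁ v) (inc₃ v) in
      s , flow , λ p≈0 → *-≉0 (*-≉0 (ε≉0 (inc₂ v)) (t≉0 (e₂ v))) (*-≉0 (ε≉0 (inc₁ v)) s₁≉0) (begin
        out t v (e₂ v) * out s v (e₁ v)
          ≈⟨ solve 3 (λ x a e → x := x :- a :* (e :* :con (+ 0))) refl _ (out t v (e₁ v)) (ε v (e₂ v)) ⟩
        out t v (e₂ v) * out s v (e₁ v) - out t v (e₁ v) * (ε v (e₂ v) * 0#)
          ≈⟨ +-congˡ (-‿cong (*-congˡ (*-congˡ (sym (s≈0 (e₂ v) (inc₂ v) (e₁≢e₂ v ∘ ≡.sym) (e₂≢e₃ v)))))) ⟩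
        out t v (e₂ v) * out s v (e₁ v) - out t v (e₁ v) * out s v (e₂ v)
          ≈⟨ sym (point≈ t v s) ⟩
        point t v s
          ≈⟨ p≈0 ⟩
        0# ∎)

    -- A form supported at `v` is a vector of the line L_v, and vanishing on `t` places it in H. So
    -- L_v meets H in a single projective point.
    point-unique : ∀ v (a : Fin e → Carrier) → (∀ x → ¬ Inc v x → a x ≈ 0#) →
      sum (λ x → a x * t x) ≈ 0# →
      ∃ λ μ → ∀ s → IsFlow s → sum (λ x → a x * s x) ≈ μ * point t v s
    point-unique v a a-off at≈0 = μ , λ s flow → begin
      sum (λ x → a x * s x)
        ≈⟨ pairing s ⟩
      _ ≈⟨ local-multiple (out a v (e₁ v)) (out a v (e₂ v)) (out a v (e₃ v))
             (out t v (e₁ v)) (out t v (e₂ v)) (out t v (e₃ v)) (out t⁻¹ v (e₂ v))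
             (trans (sym (∂-star t v)) (t-flow v)) (out-inverse (inc₂ v)) (trans (sym (pairing t)) at≈0)
             (out s v (e₁ v)) (out s v (e₂ v)) (out s v (e₃ v)) (trans (sym (∂-star s v)) (flow v)) ⟩
      μ * (out t v (e₂ v) * out s v (e₁ v) - out t v (e₁ v) * out s v (e₂ v))
        ≈⟨ *-congˡ (sym (point≈ t v s)) ⟩
      μ * point t v s ∎
      where
      μ : Carrier
      μ = (out a v (e₁ v) - out a v (e₃ v)) * out t⁻¹ v (e₂ v)
      edge : ∀ {x} s → Inc v x → a x * s x ≈ out a v x * out s v x
      edge {x} s inc = begin
        a x * s x
          ≈⟨ sym (trans (*-congʳ (ε² inc)) (*-identityˡ _)) ⟩
        (ε v x * ε v x) * (a x * s x)
          ≈⟨ solve 3 (λ e a s → (e :* e) :* (a :* s) := (e :* a) :* (e :* s)) refl (ε v x) (a x) (s x) ⟩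
        out a v x * out s v x ∎
      pairing : ∀ s → sum (λ x → a x * s x) ≈
        out a v (e₁ v) * out s v (e₁ v) + out a v (e₂ v) * out s v (e₂ v) + out a v (e₃ v) * out s v (e₃ v)
      pairing s = trans (star-sum v (λ x → a x * s x) (λ x ¬inc → trans (*-congʳ (a-off x ¬inc)) (zeroˡ _)))
                        (+-cong (+-cong (edge s (inc₁ v)) (edge s (inc₂ v))) (edge s (inc₃ v)))

-- Double negation over finite sets, and a dimension count.

¬¬-all : ∀ {m} {A : Fin m → Set} → (∀ i → ¬ ¬ A i) → ¬ ¬ (∀ i → A i)
¬¬-all {zero}  a k = k (λ ())
¬¬-all {suc m} a k = a zero λ a₀ → ¬¬-all (a ∘ suc) λ as → k λ { zero → a₀ ; (suc i) → as i }

erase : ∀ {n} → Subset n → Fin n → Subset n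
erase p x = p [ x ]≔ outside

∣p∣≤1+∣erase∣ : ∀ {n} (p : Subset n) x → ∣ p ∣ ≤ suc ∣ erase p x ∣
∣p∣≤1+∣erase∣ (inside  ∷ p) zero    = ℕₚ.≤-refl
∣p∣≤1+∣erase∣ (outside ∷ p) zero    = ℕₚ.n≤1+n _
∣p∣≤1+∣erase∣ (inside  ∷ p) (suc x) = s≤s (∣p∣≤1+∣erase∣ p x)
∣p∣≤1+∣erase∣ (outside ∷ p) (suc x) = ∣p∣≤1+∣erase∣ p x

x∉erase : ∀ {n} (p : Subset n) x → x ∉ erase p x
x∉erase (_ ∷ p) (suc x) (there x∈) = x∉erase p x x∈

erase-⊆ : ∀ {n} (p : Subset n) x {y} → y ∈ erase p x → y ∈ p
erase-⊆ (_ ∷ p) zero    (there y∈) = there y∈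
erase-⊆ (_ ∷ p) (suc x) here       = here
erase-⊆ (_ ∷ p) (suc x) (there y∈) = there (erase-⊆ p x y∈)

module Dimension (K : ACField) where
  open ACField K hiding (zero)
  open Integers cring
  open Sums cring
  open Polynomials K using (*-≉0)
  open Solver using (solve; _:=_; _:*_; _:-_; :-_) renaming (con to :con)
  open import Relation.Binary.Reasoning.Setoid setoid

  record RelationOn {n m} (S : Subset n) (T : Subset m) (V : Fin n → Fin m → Carrier) : Set where
    field
      coeff    : Fin n → Carrier
      support  : ∀ v → v ∉ S → coeff v ≈ 0#
      pivot    : Fin n
      pivot≉0  : ¬ coeff pivot ≈ 0#
      relation : ∀ j → j ∈ T → sum (λ v → coeff v * V v j) ≈ 0#

  module Pivot {n m} (S : Subset n) (T : Subset m) (V : Fin n → Fin (suc m) → Carrier)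
               (i : Fin n) (i∈S : i ∈ S) (a≉0 : ¬ V i zero ≈ 0#) where
    a : Carrier
    a = V i zero

    V′ : Fin n → Fin (suc m) → Carrier
    V′ v j = a * V v j - (V v zero * V i j)

    module _ (r : RelationOn (erase S i) T (λ v j → V′ v (suc j))) where
      open RelationOn r renaming (coeff to c′)

      b : Carrier
      b = sum (λ v → c′ v * V v zero)

      -- Elimination subtracted multiples of row `i` that add up to `b` times that row. The
      -- coefficient at `i` restores them, and all other coefficients are scaled by `a`.
      c : Fin n → Carrier
      c v = a * c′ v - (δ i v * b)

      sum-c : ∀ j → sum (λ v → c v * V v j) ≈ sum (λ v → c′ v * V′ v j)
      sum-c j = begin
        sum (λ v → c v * V v j)
          ≈⟨ sum-cong-≋ (λ v → solve 5 (λ a c d b x → (a :* c :- d :* b) :* x := c :* (a :* x) :- d :* (b :* x))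
               refl a (c′ v) (δ i v) b (V v j)) ⟩
        sum (λ v → c′ v * (a * V v j) - (δ i v * (b * V v j)))
          ≈⟨ sum-sub (λ v → c′ v * (a * V v j)) _ ⟩
        sum (λ v → c′ v * (a * V v j)) - sum (λ v → δ i v * (b * V v j))
          ≈⟨ +-congˡ (-‿cong (trans (sum-δ i (λ v → b * V v j)) (sum-* (V i j) (λ v → c′ v * V v zero)))) ⟩
        sum (λ v → c′ v * (a * V v j)) - sum (λ v → c′ v * V v zero * V i j)
          ≈⟨ sym (sum-sub (λ v → c′ v * (a * V v j)) _) ⟩
        sum (λ v → c′ v * (a * V v j) - (c′ v * V v zero * V i j))
          ≈⟨ sum-cong-≋ (λ v → solve 5 (λ c a x y z → c :* (a :* x) :- c :* y :* z := c :* (a :* x :- y :* z))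
               refl (c′ v) a (V v j) (V v zero) (V i j)) ⟩
        sum (λ v → c′ v * V′ v j) ∎

      lift : RelationOn S (inside ∷ T) V
      lift = record
        { coeff = c
        ; support = λ v v∉S → begin
            a * c′ v - (δ i v * b)
              ≈⟨ +-cong (*-congˡ (support v (v∉S ∘ erase-⊆ S i)))
                        (-‿cong (*-congʳ (δ-≢ {a = i} {v} λ { ≡.refl → v∉S i∈S }))) ⟩
            a * 0# - (0# * b)
              ≈⟨ solve 2 (λ a b → a :* :con (+ 0) :- :con (+ 0) :* b := :con (+ 0)) refl a b ⟩
            0# ∎
        ; pivot = pivot
        ; pivot≉0 = λ c≈0 → *-≉0 a≉0 pivot≉0 (begin
            a * c′ pivot
              ≈⟨ solve 2 (λ x b → x := x :- :con (+ 0) :* b) refl _ b ⟩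
            a * c′ pivot - (0# * b)
              -- `pivot` differs from `i`, since `c′` vanishes off `erase S i`.
              ≈⟨ +-congˡ (-‿cong (*-congʳ (sym (δ-≢ {a = i} {pivot}
                   (λ { ≡.refl → pivot≉0 (support i (x∉erase S i)) }))))) ⟩
            c pivot
              ≈⟨ c≈0 ⟩
            0# ∎)
        ; relation = λ
            { zero _ → trans (sum-c zero) (sum-zero (λ v →
                solve 3 (λ c a x → c :* (a :* x :- x :* a) := :con (+ 0)) refl (c′ v) a (V v zero)))
            ; (suc j) j∈T → trans (sum-c (suc j)) (relation j (drop-there j∈T)) }
        }

  -- Choosing pivots needs zero tests in `K`, so the relation exists only up to double negation;
  -- this suffices for deriving contradictions.
  more-rows-than-columns : ∀ {n m} (S : Subset n) (T : Subset m) (V : Fin n → Fin m → Carrier) →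
                           ∣ T ∣ < ∣ S ∣ → ¬ ¬ RelationOn S T V
  more-rows-than-columns {n} S [] V 0<∣S∣ k with nonempty? S
  ... | yes (i , i∈S) = k record
    { coeff = δ i
    ; support = λ v v∉S → δ-≢ {a = i} {v} (λ { ≡.refl → v∉S i∈S })
    ; pivot = i
    ; pivot≉0 = λ δ≈0 → 1≉0 (trans (sym (δ-refl i)) δ≈0)
    ; relation = λ ()
    }
  ... | no empty rewrite Empty-unique empty | ∣⊥∣≡0 n = contradiction 0<∣S∣ λ ()
  more-rows-than-columns S (outside ∷ T) V lt k =
    more-rows-than-columns S T (λ v j → V v (suc j)) lt λ r → let open RelationOn r in
    k record { coeff = coeff ; support = support ; pivot = pivot ; pivot≉0 = pivot≉0
             ; relation = λ { (suc j) j∈T → relation j (drop-there j∈T) } }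
  more-rows-than-columns S (inside ∷ T) V lt k =
    -- The goal is ⊥, so all zero tests in the first column may be assumed decided at once.
    ¬¬-all (λ v → ¬¬-excluded-middle {A = V v zero ≈ 0#}) λ dec →
    [ (λ V₀≈0 → more-rows-than-columns S T (λ v j → V v (suc j)) (ℕₚ.<-trans (ℕₚ.n<1+n _) lt) λ r →
         let open RelationOn r in
         k record { coeff = coeff ; support = support ; pivot = pivot ; pivot≉0 = pivot≉0
                  ; relation = λ
                      { zero _ → sum-zero (λ v → column₀ (support v) (V₀≈0 v))
                      ; (suc j) j∈T → relation j (drop-there j∈T) } })
    , (λ (i , i∈S , a≉0) →
         more-rows-than-columns (erase S i) T (λ v j → Pivot.V′ S T V i i∈S a≉0 v (suc j))
           (ℕₚ.≤-pred (ℕₚ.≤-trans lt (∣p∣≤1+∣erase∣ S i))) λ r →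
         k (Pivot.lift S T V i i∈S a≉0 r))
    ]′ (zero-or-exists (λ v → classify v (dec v)))
    where
    classify : ∀ v → Dec (V v zero ≈ 0#) → (v ∈ S → V v zero ≈ 0#) ⊎ (v ∈ S × ¬ V v zero ≈ 0#)
    classify v d with v ∈? S | d
    ... | no v∉S  | _       = inj₁ (λ v∈S → contradiction v∈S v∉S)
    ... | yes v∈S | yes V≈0 = inj₁ (λ _ → V≈0)
    ... | yes v∈S | no V≉0  = inj₂ (v∈S , V≉0)
    column₀ : ∀ {v c} → (v ∉ S → c ≈ 0#) → (v ∈ S → V v zero ≈ 0#) → c * V v zero ≈ 0#
    column₀ {v} off on with v ∈? S
    ... | yes v∈S = trans (*-congˡ (on v∈S)) (zeroʳ _)
    ... | no v∉S  = trans (*-congʳ (off v∉S)) (zeroˡ _)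

-- The generic matroid and its self-duality.

module GraphMatroid (K : ACField) {n e : ℕ} (G : Graph n e)
                    (trivalent : Trivalent G) (connected : ThreeConnected G) where
  open ACField K hiding (zero)
  open Integers cring
  open Sums cring
  open Polynomials K
  open Solver using (solve; _:=_; _:*_)
  open Flows K G trivalent connected
  open Section K G trivalent connected
  open import Relation.Binary.Reasoning.Setoid setoid
  private
    module E = Sums (exprRing e)
  open Elimination (exprRing e) NonVanishing zero-or-nonVanishing nonVanishing-1 nonVanishing-*
    using (Dependency; RightInverse; dichotomy)

  eval-sum : ∀ {m} (f : Fin m → Expr e) τ → eval (E.sum f) τ ≈ sum (λ i → eval (f i) τ)
  eval-sum {zero}  f τ = refl
  eval-sum {suc m} f τ = +-congˡ (eval-sum (f ∘ suc) τ)

  eval-δ : ∀ {m} (a b : Fin m) τ → eval (E.δ a b) τ ≈ δ a b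
  eval-δ a b τ with does (a ≟ b)
  ... | true  = ι-1
  ... | false = refl

  -- Every flow is its own projection by `flow-expansion`. So all flows are parametrized,
  -- redundantly, by one variable per edge.
  project : (Fin e → Carrier) → Fin e → Carrier
  project τ x = sum (λ j → τ j * basic j x)

  project-flow : ∀ τ → IsFlow (project τ)
  project-flow τ = combination-flow τ basic basic-flow

  projectᴱ : Fin e → Expr e
  projectᴱ x = E.sum (λ j → var j ⊛ con (basicℤ j x))

  eval-project : ∀ x τ → eval (projectᴱ x) τ ≈ project τ x
  eval-project x τ = eval-sum (λ j → var j ⊛ con (basicℤ j x)) τ

  εᴱ : Fin n → Fin e → Expr e
  εᴱ v x = con (ℤΣ.δ (head x) v ℤ.- ℤΣ.δ (tail x) v)

  eval-ε : ∀ v x τ → eval (εᴱ v x) τ ≈ ε v x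
  eval-ε v x τ = trans (ι-sub (ℤΣ.δ (head x) v) (ℤΣ.δ (tail x) v))
                       (+-cong (ι-δ (head x) v) (-‿cong (ι-δ (tail x) v)))

  pointᴱ : Fin n → Fin e → Expr e
  pointᴱ v j = ((εᴱ v (e₂ v) ⊛ projectᴱ (e₂ v)) ⊛ (εᴱ v (e₁ v) ⊛ con (basicℤ j (e₁ v))))
             ⊕ (⊝ ((εᴱ v (e₁ v) ⊛ projectᴱ (e₁ v)) ⊛ (εᴱ v (e₂ v) ⊛ con (basicℤ j (e₂ v)))))

  eval-point : ∀ v j τ → eval (pointᴱ v j) τ ≈ point (project τ) v (basic j)
  eval-point v j τ = trans
    (+-cong (*-cong (*-cong (eval-ε v (e₂ v) τ) (eval-project (e₂ v) τ)) (*-congʳ (eval-ε v (e₁ v) τ)))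
            (-‿cong (*-cong (*-cong (eval-ε v (e₁ v) τ) (eval-project (e₁ v) τ)) (*-congʳ (eval-ε v (e₂ v) τ)))))
    (sym (point≈ (project τ) v (basic j)))

  Outcome : Subset n → Set
  Outcome S = Dependency S pointᴱ ⊎ RightInverse S pointᴱ

  abstract
    decide : ∀ S → Outcome S
    decide S = dichotomy S pointᴱ

  isIndependent : ∀ {S} → Outcome S → Bool
  isIndependent (inj₁ _) = false
  isIndependent (inj₂ _) = true

  -- If this does not vanish at `τ`, the outcome remains valid there: a dependency stays nontrivial,
  -- and a right inverse keeps a nonzero denominator.
  witnessOf : ∀ {S} → Outcome S → Expr e
  witnessOf (inj₁ d) = Dependency.coeff d (Dependency.pivot d)
  witnessOf (inj₂ i) = RightInverse.denom i

  witnessOf-nonVanishing : ∀ {S} (o : Outcome S) → NonVanishing (witnessOf o)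
  witnessOf-nonVanishing (inj₁ d) = Dependency.pivot-NZ d
  witnessOf-nonVanishing (inj₂ i) = RightInverse.denom-NZ i

  M : Subset n → Bool
  M S = isIndependent (decide S)

  certificate : Subset n → Expr e
  certificate S = witnessOf (decide S)

  certificate-nonVanishing : ∀ S → NonVanishing (certificate S)
  certificate-nonVanishing S = witnessOf-nonVanishing (decide S)

  -- A flow `s` with `s x` nonzero is itself a parameter value at which the polynomial takes the
  -- value `s x`.
  project-nonVanishing : ∀ x → NonVanishing (projectᴱ x)
  project-nonVanishing x = [ (λ t≈0 → ⊥-elim (s≉0 (begin
      s x                    ≈⟨ sym (flow-expansion flow x) ⟩
      project s x            ≈⟨ sym (eval-project x s) ⟩
      eval (projectᴱ x) s    ≈⟨ t≈0 s ⟩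
      0#                     ∎))) , (λ nv → nv) ]′ (zero-or-nonVanishing (projectᴱ x))
    where
    s = proj₁ (edge-in-flow x)
    flow = proj₁ (proj₂ (edge-in-flow x))
    s≉0 = proj₂ (proj₂ (edge-in-flow x))

  ∏ : ∀ {m} → (Fin m → Expr e) → Expr e
  ∏ {zero}  f = con (+ 1)
  ∏ {suc m} f = f zero ⊛ ∏ (f ∘ suc)

  ∏-nonVanishing : ∀ {m} (f : Fin m → Expr e) → (∀ i → NonVanishing (f i)) → NonVanishing (∏ f)
  ∏-nonVanishing {zero}  f nv = nonVanishing-1
  ∏-nonVanishing {suc m} f nv = nonVanishing-* (f zero) _ (nv zero) (∏-nonVanishing (f ∘ suc) (nv ∘ suc))

  ∏-factor : ∀ {m} (f : Fin m → Expr e) τ → ¬ eval (∏ f) τ ≈ 0# → ∀ i → ¬ eval (f i) τ ≈ 0#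
  ∏-factor {suc m} f τ ∏≉0 zero    f≈0 = ∏≉0 (trans (*-congʳ f≈0) (zeroˡ _))
  ∏-factor {suc m} f τ ∏≉0 (suc i) = ∏-factor (f ∘ suc) τ (λ ∏≈0 → ∏≉0 (trans (*-congˡ ∏≈0) (zeroʳ _))) i

  ∏ˢ : ∀ {m} → (Subset m → Expr e) → Expr e
  ∏ˢ {zero}  f = f []
  ∏ˢ {suc m} f = ∏ˢ (f ∘ (inside ∷_)) ⊛ ∏ˢ (f ∘ (outside ∷_))

  ∏ˢ-nonVanishing : ∀ {m} (f : Subset m → Expr e) → (∀ S → NonVanishing (f S)) → NonVanishing (∏ˢ f)
  ∏ˢ-nonVanishing {zero}  f nv = nv []
  ∏ˢ-nonVanishing {suc m} f nv = nonVanishing-* (∏ˢ (f ∘ (inside ∷_))) (∏ˢ (f ∘ (outside ∷_)))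
    (∏ˢ-nonVanishing _ (nv ∘ (inside ∷_))) (∏ˢ-nonVanishing _ (nv ∘ (outside ∷_)))

  ∏ˢ-factor : ∀ {m} (f : Subset m → Expr e) τ → ¬ eval (∏ˢ f) τ ≈ 0# → ∀ S → ¬ eval (f S) τ ≈ 0#
  ∏ˢ-factor {zero}  f τ ∏≉0 []            = ∏≉0
  ∏ˢ-factor {suc m} f τ ∏≉0 (inside ∷ S)  =
    ∏ˢ-factor (f ∘ (inside ∷_)) τ (λ ∏≈0 → ∏≉0 (trans (*-congʳ ∏≈0) (zeroˡ _))) S
  ∏ˢ-factor {suc m} f τ ∏≉0 (outside ∷ S) =
    ∏ˢ-factor (f ∘ (outside ∷_)) τ (λ ∏≈0 → ∏≉0 (trans (*-congˡ ∏≈0) (zeroʳ _))) S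

  -- The first factor makes every `t x` invertible, so that the weights exist; the second preserves
  -- the outcomes for all subsets.
  generic : Expr e
  generic = ∏ projectᴱ ⊛ ∏ˢ certificate

  generic-nonVanishing : NonVanishing generic
  generic-nonVanishing = nonVanishing-* (∏ projectᴱ) (∏ˢ certificate)
    (∏-nonVanishing projectᴱ project-nonVanishing) (∏ˢ-nonVanishing certificate certificate-nonVanishing)

  abstract
    genericPoint : ∃ λ τ → ¬ eval generic τ ≈ 0#
    genericPoint = let x , x≉0 = Eventually-∃ e (eventually generic-nonVanishing) in natPoint x , x≉0

  module Generic (τ : Fin e → Carrier) (τ-generic : ¬ eval generic τ ≈ 0#) where
    t : Fin e → Carrier
    t = project τ

    t≉0 : ∀ x → ¬ t x ≈ 0#
    t≉0 x t≈0 = ∏-factor projectᴱ τ (λ ∏≈0 → τ-generic (trans (*-congʳ ∏≈0) (zeroˡ _))) x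
                  (trans (eval-project x τ) t≈0)

    certificate≉0 : ∀ S → ¬ eval (certificate S) τ ≈ 0#
    certificate≉0 = ∏ˢ-factor certificate τ (λ ∏≈0 → τ-generic (trans (*-congˡ ∏≈0) (zeroʳ _)))

    open Hyperplane t (project-flow τ) t≉0 public

    record DependentAt (S : Subset n) : Set where
      field
        coeff    : Fin n → Carrier
        support  : ∀ v → v ∉ S → coeff v ≈ 0#
        pivot    : Fin n
        pivot≉0  : ¬ coeff pivot ≈ 0#
        relation : ∀ j → sum (λ v → coeff v * point t v (basic j)) ≈ 0#

    record InvertibleAt (S : Subset n) : Set where
      field
        denom   : Carrier
        denom≉0 : ¬ denom ≈ 0#
        inv     : Fin n → Fin e → Carrier
        right   : ∀ u → u ∈ S → ∀ v → sum (λ j → point t u (basic j) * inv v j) ≈ denom * δ u v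

    cases : ∀ {S} (o : Outcome S) → ¬ eval (witnessOf o) τ ≈ 0# →
            (isIndependent o ≡ false × DependentAt S) ⊎ (isIndependent o ≡ true × InvertibleAt S)
    cases (inj₁ d) cert≉0 = inj₁ (≡.refl , record
      { coeff = λ v → eval (coeff v) τ
      ; support = λ v v∉S → support v v∉S τ
      ; pivot = pivot
      ; pivot≉0 = cert≉0
      ; relation = λ j → begin
          sum (λ v → eval (coeff v) τ * point t v (basic j))
            ≈⟨ sum-cong-≋ (λ v → *-congˡ (sym (eval-point v j τ))) ⟩
          sum (λ v → eval (coeff v ⊛ pointᴱ v j) τ)
            ≈⟨ sym (eval-sum (λ v → coeff v ⊛ pointᴱ v j) τ) ⟩
          eval (E.sum (λ v → coeff v ⊛ pointᴱ v j)) τ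
            ≈⟨ relation j τ ⟩
          0# ∎ })
      where open Dependency d
    cases (inj₂ i) cert≉0 = inj₂ (≡.refl , record
      { denom = eval denom τ
      ; denom≉0 = cert≉0
      ; inv = λ v j → eval (inv v j) τ
      ; right = λ u u∈S v → begin
          sum (λ j → point t u (basic j) * eval (inv v j) τ)
            ≈⟨ sum-cong-≋ (λ j → *-congʳ (sym (eval-point u j τ))) ⟩
          sum (λ j → eval (pointᴱ u j ⊛ inv v j) τ)
            ≈⟨ sym (eval-sum (λ j → pointᴱ u j ⊛ inv v j) τ) ⟩
          eval (E.sum (λ j → pointᴱ u j ⊛ inv v j)) τ
            ≈⟨ right u u∈S v τ ⟩
          eval denom τ * eval (E.δ u v) τ
            ≈⟨ *-congˡ (eval-δ u v τ) ⟩
          eval denom τ * δ u v ∎ })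
      where open RightInverse i using (denom; inv) renaming (inverse to right)

    abstract
      M-cases : ∀ S → (M S ≡ false × DependentAt S) ⊎ (M S ≡ true × InvertibleAt S)
      M-cases S = cases (decide S) (certificate≉0 S)

    invertible : ∀ {S} → M S ≡ true → InvertibleAt S
    invertible {S} MS = [ (λ (MS′ , _) → contradiction (≡.trans (≡.sym MS) MS′) λ ()) , proj₂ ]′ (M-cases S)

    dependent : ∀ {S} → M S ≢ true → DependentAt S
    dependent {S} MS = [ proj₂ , (λ (MS′ , _) → contradiction MS′ MS) ]′ (M-cases S)

    -- Pairing the relation with column `v` of the inverse leaves `denom * c v`. The inverse
    -- controls only rows in `S`, and `c` vanishes on the others.
    independent : ∀ {S} → M S ≡ true → ∀ (c : Fin n → Carrier) → (∀ v → v ∉ S → c v ≈ 0#) →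
                  (∀ j → sum (λ v → c v * point t v (basic j)) ≈ 0#) → ∀ v → c v ≈ 0#
    independent {S} MS c c-off rel v = cancel-≉0 denom≉0 (begin
      denom * c v
        ≈⟨ sym (sum-δ v (λ u → denom * c u)) ⟩
      sum (λ u → δ v u * (denom * c u))
        ≈⟨ sum-cong-≋ (λ u → trans (*-congʳ (δ-sym v u))
             (solve 3 (λ d D c → d :* (D :* c) := c :* (D :* d)) refl (δ u v) denom (c u))) ⟩
      sum (λ u → c u * (denom * δ u v))
        ≈⟨ sum-cong-≋ (λ u → row u) ⟩
      sum (λ u → c u * sum (λ j → inv v j * point t u (basic j)))
        ≈⟨ sum-combination c (inv v) (λ j u → point t u (basic j)) ⟩
      sum (λ j → inv v j * sum (λ u → c u * point t u (basic j)))
        ≈⟨ sum-zero (λ j → trans (*-congˡ (rel j)) (zeroʳ _)) ⟩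
      0# ∎)
      where
      open InvertibleAt (invertible {S} MS)
      row : ∀ u → c u * (denom * δ u v) ≈ c u * sum (λ j → inv v j * point t u (basic j))
      row u with u ∈? S
      ... | yes u∈S = *-congˡ (trans (sym (right u u∈S v)) (sum-cong-≋ (λ j → *-comm _ (inv v j))))
      ... | no u∉S  = trans (trans (*-congʳ (c-off u u∉S)) (zeroˡ _))
                            (sym (trans (*-congʳ (c-off u u∉S)) (zeroˡ _)))

    -- A dual basis for the points in `S`, up to the factor `denom`: a combination over `S` of these
    -- flows is determined by its values on `S`.
    dualFlow : ∀ {S} → M S ≡ true → Fin n → Fin e → Carrier
    dualFlow {S} MS v = project (InvertibleAt.inv (invertible {S} MS) v)

    point-dualFlow : ∀ {S} (MS : M S ≡ true) u → u ∈ S → ∀ v →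
      point t u (dualFlow {S} MS v) ≈ InvertibleAt.denom (invertible {S} MS) * δ u v
    point-dualFlow {S} MS u u∈S v = trans (sum-combination (coord t u) (inv v) basic)
      (trans (sum-cong-≋ (λ j → *-comm (inv v j) _)) (right u u∈S v))
      where open InvertibleAt (invertible {S} MS)

    dual-coefficient : ∀ {S} (MS : M S ≡ true) (c : Fin n → Carrier) → (∀ v → v ∉ S → c v ≈ 0#) →
      (∀ u → u ∈ S → sum (λ v → c v * point t u (dualFlow {S} MS v)) ≈ 0#) → ∀ v → c v ≈ 0#
    dual-coefficient {S} MS c c-off rel v with v ∈? S
    ... | no v∉S  = c-off v v∉S
    ... | yes v∈S = cancel-≉0 denom≉0 (begin
      denom * c v                                       ≈⟨ sym (sum-δ v (λ u → denom * c u)) ⟩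
      sum (λ u → δ v u * (denom * c u))                 ≈⟨ sum-cong-≋ (λ u →
        trans (solve 3 (λ d D c → d :* (D :* c) := c :* (D :* d)) refl (δ v u) denom (c u))
              (*-congˡ (sym (point-dualFlow {S} MS v v∈S u)))) ⟩
      sum (λ u → c u * point t v (dualFlow {S} MS u))   ≈⟨ rel v v∈S ⟩
      0#                                                ∎)
      where open InvertibleAt (invertible {S} MS)

    -- Isotropy turns a flow whose points vanish off S into a linear relation supported on S.
    supported-zero : ∀ {S} → M S ≡ true → ∀ {s} → IsFlow s → (∀ v → v ∉ S → point t v s ≈ 0#) →
                     ∀ v → point t v s ≈ 0#
    supported-zero {S} MS {s} flow off v = cancel-≉0 (weight≉0 v)
      (independent {S} MS (λ v → weight v * point t v s)
        (λ v v∉S → trans (*-congˡ (off v v∉S)) (zeroʳ _))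
        (λ j → trans (sum-cong-≋ (λ v → *-assoc (weight v) (point t v s) (point t v (basic j))))
                     (isotropic flow (basic-flow j))) v)

    record SupportedFlow (S : Subset n) : Set where
      field
        flow      : Fin e → Carrier
        isFlow    : IsFlow flow
        off       : ∀ v → v ∉ S → point t v flow ≈ 0#
        witness   : Fin n
        witness≉0 : ¬ point t witness flow ≈ 0#

    abstract
      -- The converse of `supported-zero`: coisotropy realizes the coefficients of a dependency as
      -- the weighted points of a flow.
      supported-nonzero : ∀ {S} → M S ≢ true → SupportedFlow S
      supported-nonzero {S} MS = record
        { flow = s ; isFlow = s-flow
        ; off = λ v v∉S → cancel-≉0 (weight≉0 v) (trans (ws≈c v) (support v v∉S))
        ; witness = pivot
        ; witness≉0 = λ p≈0 → pivot≉0 (trans (sym (ws≈c pivot)) (trans (*-congˡ p≈0) (zeroʳ _))) }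
        where
        open DependentAt (dependent {S} MS)
        s : Fin e → Carrier
        s = proj₁ (coisotropic coeff relation)
        s-flow : IsFlow s
        s-flow = proj₁ (proj₂ (coisotropic coeff relation))
        ws≈c : ∀ v → weight v * point t v s ≈ coeff v
        ws≈c = proj₂ (proj₂ (coisotropic coeff relation))

  open Generic (proj₁ genericPoint) (proj₂ genericPoint)
  open Dimension K

  -- If `S` were larger than its complement, a nontrivial combination of the dual flows would vanish
  -- off `S`, hence everywhere by `supported-zero`. But its values on `S` determine the
  -- coefficients.
  size-bound : ∀ {S} → M S ≡ true → ∣ S ∣ ≤ ∣ ∁ S ∣
  size-bound {S} MS with ∣ S ∣ ℕₚ.≤? ∣ ∁ S ∣
  ... | yes le = le
  ... | no ¬le = ⊥-elim (more-rows-than-columns S (∁ S) (λ v u → point t u (z v)) (ℕₚ.≰⇒> ¬le) λ r →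
    let open RelationOn r
        s : Fin e → Carrier
        s x = sum (λ v → coeff v * z v x)
        point-s : ∀ u → point t u s ≈ sum (λ v → coeff v * point t u (z v))
        point-s u = sum-combination (coord t u) coeff z
        s≈0 : ∀ u → point t u s ≈ 0#
        s≈0 = supported-zero {S} MS (combination-flow coeff z (λ v → project-flow _))
                (λ u u∉S → trans (point-s u) (relation u (x∉p⇒x∈∁p u∉S)))
    in pivot≉0 (dual-coefficient {S} MS coeff support (λ u u∈S → trans (sym (point-s u)) (s≈0 u)) pivot))
    where
    z = dualFlow {S} MS

  -- A dependency of `∁ B` gives a nonzero flow supported on `∁ B`. Together with the dual flows of
  -- `B` there is one flow too many, so a nontrivial combination vanishes off `B`, hence everywhere.
  -- Its values on `B` kill the dual coefficients, and then the witness kills the remaining one.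
  dual : ∀ {B} → M B ≡ true → ∣ B ∣ ≡ ∣ ∁ B ∣ → M (∁ B) ≡ true
  dual {B} MB ∣B∣ with M (∁ B) Boolₚ.≟ true
  ... | yes M∁B = M∁B
  ... | no ¬M∁B = ⊥-elim (more-rows-than-columns (inside ∷ B) (∁ B) (λ v u → point t u (z v))
                            (s≤s (ℕₚ.≤-reflexive (≡.sym ∣B∣))) absurd)
    where
    open SupportedFlow (supported-nonzero {∁ B} ¬M∁B)
    z : Fin (suc n) → Fin e → Carrier
    z zero    = flow
    z (suc v) = dualFlow {B} MB v
    z-flow : ∀ v → IsFlow (z v)
    z-flow zero    = isFlow
    z-flow (suc v) = project-flow _
    absurd : RelationOn (inside ∷ B) (∁ B) (λ v u → point t u (z v)) → ⊥
    absurd r = pivot-zero pivot pivot≉0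
      where
      open RelationOn r
      s : Fin e → Carrier
      s x = sum (λ v → coeff v * z v x)
      s≈0 : ∀ u → sum (λ v → coeff v * point t u (z v)) ≈ 0#
      s≈0 u = trans (sym (sum-combination (coord t u) coeff z))
        (supported-zero {B} MB (combination-flow coeff z z-flow)
          (λ u u∉B → trans (sum-combination (coord t u) coeff z) (relation u (x∉p⇒x∈∁p u∉B))) u)
      suc≈0 : ∀ v → coeff (suc v) ≈ 0#
      suc≈0 = dual-coefficient {B} MB (coeff ∘ suc) (λ v v∉B → support (suc v) (v∉B ∘ drop-there))
        (λ u u∈B → begin
          sum (λ v → coeff (suc v) * point t u (dualFlow {B} MB v))
            ≈⟨ sym (+-identityˡ _) ⟩
          0# + sum (λ v → coeff (suc v) * point t u (dualFlow {B} MB v))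
            ≈⟨ +-congʳ (sym (trans (*-congˡ (off u (λ u∈∁B → x∈∁p⇒x∉p u∈∁B u∈B))) (zeroʳ _))) ⟩
          sum (λ v → coeff v * point t u (z v))
            ≈⟨ s≈0 u ⟩
          0# ∎)
      pivot-zero : ∀ i → ¬ coeff i ≈ 0# → ⊥
      pivot-zero (suc i) c≉0 = c≉0 (suc≈0 i)
      pivot-zero zero    c≉0 = witness≉0 (cancel-≉0 c≉0 (begin
        coeff zero * point t witness flow
          ≈⟨ sym (+-identityʳ _) ⟩
        coeff zero * point t witness flow + 0#
          ≈⟨ +-congˡ (sym (sum-zero (λ v → trans (*-congʳ (suc≈0 v)) (zeroˡ _)))) ⟩
        sum (λ v → coeff v * point t witness (z v))
          ≈⟨ s≈0 witness ⟩
        0# ∎))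

  Maximal : Subset n → Set
  Maximal S = ∀ v → v ∉ S → M (S ∪ ⁅ v ⁆) ≢ true

  -- Take a nonzero flow supported on `∁ S`, and `i` with a nonzero value. A relation on S ∪ {i}
  -- applied to this flow keeps only its `i`-th term, whose coefficient is nonzero because `S` is
  -- independent.
  complement-of-maximal : ∀ {S} → M S ≡ true → Maximal S → M (∁ S) ≡ true
  complement-of-maximal {S} MS maximal with M (∁ S) Boolₚ.≟ true
  ... | yes M∁S = M∁S
  ... | no ¬M∁S = ⊥-elim (¬i∉S (λ i∈S → witness≉0 (off i (λ i∈∁S → x∈∁p⇒x∉p i∈∁S i∈S))))
    where
    open SupportedFlow (supported-nonzero {∁ S} ¬M∁S) renaming (witness to i)
    ¬i∉S : ¬ (i ∉ S)
    ¬i∉S i∉S = witness≉0 (cancel-≉0 cᵢ≉0 (begin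
      coeff i * point t i flow
        ≈⟨ sym (sum-single i (λ v → coeff v * point t v flow) elsewhere) ⟩
      sum (λ v → coeff v * point t v flow)
        ≈⟨ relation-flow t coeff relation isFlow ⟩
      0# ∎))
      where
      open DependentAt (dependent {S ∪ ⁅ i ⁆} (maximal i i∉S))
      off-S : ∀ v → v ≢ i → v ∉ S → coeff v ≈ 0#
      off-S v v≢i v∉S = support v (λ v∈ → [ v∉S , (λ v∈i → v≢i (x∈⁅y⁆⇒x≡y i v∈i)) ]′ (x∈p∪q⁻ S ⁅ i ⁆ v∈))
      elsewhere : ∀ v → v ≢ i → coeff v * point t v flow ≈ 0#
      elsewhere v v≢i with v ∈? S
      ... | yes v∈S = trans (*-congˡ (off v (λ v∈∁S → x∈∁p⇒x∉p v∈∁S v∈S))) (zeroʳ _)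
      ... | no v∉S  = trans (*-congʳ (off-S v v≢i v∉S)) (zeroˡ _)
      cᵢ≉0 : ¬ coeff i ≈ 0#
      cᵢ≉0 cᵢ≈0 = pivot≉0 (independent {S} MS coeff zero-off-S relation pivot)
        where
        zero-off-S : ∀ v → v ∉ S → coeff v ≈ 0#
        zero-off-S v v∉S with v ≟ i
        ... | yes ≡.refl = cᵢ≈0
        ... | no v≢i     = off-S v v≢i v∉S

  -- `k` bounds the number of vertices that can still be added, and makes the recursion terminate.
  extend-to-maximal : ∀ k S → M S ≡ true → n ≤ ∣ S ∣ ℕ.+ k → ∃ λ S′ → M S′ ≡ true × Maximal S′
  extend-to-maximal k S MS n≤ with any? (λ v → ¬? (v ∈? S) ×-dec (M (S ∪ ⁅ v ⁆) Boolₚ.≟ true))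
  ... | no none = S , MS , λ v v∉S MSv → none (v , v∉S , MSv)
  ... | yes (v , v∉S , MSv) = continue k n≤
    where
    grows : ∣ S ∣ < ∣ S ∪ ⁅ v ⁆ ∣
    grows = p⊂q⇒∣p∣<∣q∣ (p⊆p∪q ⁅ v ⁆ , v , q⊆p∪q S ⁅ v ⁆ (x∈⁅x⁆ v) , v∉S)
    continue : ∀ k → n ≤ ∣ S ∣ ℕ.+ k → ∃ λ S′ → M S′ ≡ true × Maximal S′
    continue zero n≤ = contradiction (ℕₚ.≤-trans grows (∣p∣≤n (S ∪ ⁅ v ⁆)))
      (ℕₚ.<⇒≱ (s≤s (≡.subst (n ≤_) (ℕₚ.+-identityʳ _) n≤)))
    continue (suc k) n≤ = extend-to-maximal k (S ∪ ⁅ v ⁆) MSv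
      (ℕₚ.≤-trans n≤ (≡.subst (_≤ ∣ S ∪ ⁅ v ⁆ ∣ ℕ.+ k) (≡.sym (ℕₚ.+-suc ∣ S ∣ k)) (ℕₚ.+-monoˡ-≤ k grows)))

  M-∅ : M ∅ ≡ true
  M-∅ with M ∅ Boolₚ.≟ true
  ... | yes M∅ = M∅
  ... | no ¬M∅ = contradiction (support pivot ∉⊥) pivot≉0
    where open DependentAt (dependent {∅} ¬M∅)

  ∣p∣+∣∁p∣≡n : ∀ (S : Subset n) → ∣ S ∣ ℕ.+ ∣ ∁ S ∣ ≡ n
  ∣p∣+∣∁p∣≡n S = ≡.trans (≡.cong (∣ S ∣ ℕ.+_) (∣∁p∣≡n∸∣p∣ S)) (ℕₚ.m+[n∸m]≡n (∣p∣≤n S))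

  module _ (r : ℕ) (n≡ : n ≡ r ℕ.+ r) where
    private
      halve : ∀ {a b} → a ℕ.+ b ≡ r ℕ.+ r → a ≤ b → a ≤ r
      halve {a} {b} eq a≤b with a ℕₚ.≤? r
      ... | yes a≤r = a≤r
      ... | no a≰r = contradiction (≡.sym eq) (ℕₚ.<⇒≢
            (ℕₚ.+-mono-< (ℕₚ.≰⇒> a≰r) (ℕₚ.<-≤-trans (ℕₚ.≰⇒> a≰r) a≤b)))

      size≤ : ∀ S → M S ≡ true → ∣ S ∣ ≤ r
      size≤ S MS = halve (≡.trans (∣p∣+∣∁p∣≡n S) n≡) (size-bound {S} MS)

      complement-size : ∀ {S} → ∣ S ∣ ≡ r → ∣ ∁ S ∣ ≡ r
      complement-size {S} ∣S∣ = ℕₚ.+-cancelˡ-≡ r _ _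
        (≡.trans (≡.cong (ℕ._+ ∣ ∁ S ∣) (≡.sym ∣S∣)) (≡.trans (∣p∣+∣∁p∣≡n S) n≡))

      involutive : ∀ {m} (S : Subset m) → ∁ (∁ S) ≡ S
      involutive []            = ≡.refl
      involutive (inside ∷ S)  = ≡.cong (inside ∷_) (involutive S)
      involutive (outside ∷ S) = ≡.cong (outside ∷_) (involutive S)

      dual-basis : ∀ {B} → IsBasis M r B → IsBasis M r (∁ B)
      dual-basis {B} (MB , ∣B∣) =
        dual {B} MB (≡.trans ∣B∣ (≡.sym (complement-size {B} ∣B∣))) , complement-size {B} ∣B∣

      -- A maximal independent set and its complement are both independent, so each has at most `r`
      -- elements; together they have `r ℕ.+ r`.
      basis : ∃ λ B → IsBasis M r B
      basis with extend-to-maximal n ∅ M-∅ (ℕₚ.m≤n+m n ∣ ∅ {n} ∣)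
      ... | S , MS , maximal = S , MS , ℕₚ.≤-antisym (size≤ S MS) (ℕₚ.+-cancelʳ-≤ r r ∣ S ∣
        (≡.subst (_≤ ∣ S ∣ ℕ.+ r) (≡.trans (∣p∣+∣∁p∣≡n S) n≡)
          (ℕₚ.+-monoʳ-≤ ∣ S ∣ (size≤ (∁ S) (complement-of-maximal {S} MS maximal)))))

    selfDual : SelfDual M r
    selfDual = basis , size≤ , λ B ∣B∣ → mk⇔ (dual-basis {B})
      (λ b → ≡.subst (IsBasis M r) (involutive B) (dual-basis {∁ B} b))

-- Arbitrary cycle matrices and generic hyperplanes.

module Realization
  (K : ACField) {n e : ℕ} (G : Graph n e) (trivalent : Trivalent G) (connected : ThreeConnected G)
  {g : ℕ} (o : Lin.Orientation K G) (Cyc : Fin g → Fin e → ACField.Carrier K)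
  (cyc : Lin.CycMatrix K G g o Cyc) where
  open ACField K hiding (zero)
  open Integers cring
  open Sums cring
  open Polynomials K
  open Solver using (solve; _:=_; _:+_; _:*_; _:-_; :-_) renaming (con to :con)
  open Flows K G trivalent connected
  open Section K G trivalent connected
  open GraphMatroid K G trivalent connected
    using (M; generic; genericPoint; project; project-flow; module Generic)
  open Lin K using (Poly; con; var; _⊕_; _⊛_; evalP; ∑; inc; InCycleSpace; RepOf; Indep)
  open import Relation.Binary.Reasoning.Setoid setoid

  ∑≈sum : ∀ {m} (f : Fin m → Carrier) → ∑ f ≈ sum f
  ∑≈sum {zero}  f = refl
  ∑≈sum {suc m} f = +-congˡ (∑≈sum (f ∘ suc))

  -- Compares the orientation `o` with the one stored in `ends`; multiplication by it exchanges
  -- cycles for `o` with flows.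
  sign : Fin e → Carrier
  sign x = if o x then 1# else - 1#

  sign² : ∀ x → sign x * sign x ≈ 1#
  sign² x with o x
  ... | true  = *-identityˡ 1#
  ... | false = trans (solve 1 (λ a → :- a :* :- a := a :* a) refl 1#) (*-identityˡ 1#)

  inc≈ : ∀ v x → inc G o v x ≈ ε v x * sign x
  inc≈ v x with o x
  ... | true  = sym (*-identityʳ _)
  ... | false = sym (trans (solve 3 (λ h t a → (h :- t) :* (:- a) := (t :- h) :* a) refl
                                    (δ (head x) v) (δ (tail x) v) 1#) (*-identityʳ _))

  signed : (Fin e → Carrier) → Fin e → Carrier
  signed z x = sign x * z x

  signed-signed : ∀ z x → signed (signed z) x ≈ z x
  signed-signed z x = trans (sym (*-assoc _ _ _)) (trans (*-congʳ (sign² x)) (*-identityˡ _))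

  ∂-signed : ∀ z v → ∑ (λ x → inc G o v x * z x) ≈ ∂ (signed z) v
  ∂-signed z v = trans (∑≈sum (λ x → inc G o v x * z x))
    (sum-cong-≋ (λ x → trans (*-congʳ (inc≈ v x)) (*-assoc _ _ _)))

  row : Fin g → Fin e → Carrier
  row i = signed (Cyc i)

  row-flow : ∀ i → IsFlow (row i)
  row-flow i v = trans (sym (∂-signed (Cyc i) v)) (proj₁ cyc i v)

  coordinates : ∀ {s} → IsFlow s → ∃ λ (k : Fin g → Carrier) → ∀ x → s x ≈ sum (λ i → k i * row i x)
  coordinates {s} flow = k , λ x → begin
    s x
      ≈⟨ sym (signed-signed s x) ⟩
    sign x * signed s x
      ≈⟨ *-congˡ (trans (k≈ x) (∑≈sum (λ i → k i * Cyc i x))) ⟩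
    sign x * sum (λ i → k i * Cyc i x)
      ≈⟨ *-sum (sign x) (λ i → k i * Cyc i x) ⟩
    sum (λ i → sign x * (k i * Cyc i x))
      ≈⟨ sum-cong-≋ (λ i → solve 3 (λ a b c → a :* (b :* c) := b :* (a :* c)) refl (sign x) (k i) (Cyc i x)) ⟩
    sum (λ i → k i * row i x) ∎
    where
    inSpace : InCycleSpace G o (signed s)
    inSpace v = trans (∂-signed (signed s) v) (trans (∂-cong (signed-signed s) v) (flow v))
    k : Fin g → Carrier
    k = proj₁ (proj₂ (proj₂ cyc) (signed s) inSpace)
    k≈ : ∀ x → signed s x ≈ ∑ (λ i → k i * Cyc i x)
    k≈ = proj₂ (proj₂ (proj₂ cyc) (signed s) inSpace)

  flowOf : (Fin g → Carrier) → Fin e → Carrier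
  flowOf h x = sum (λ i → h i * row i x)

  flowOf-flow : ∀ h → IsFlow (flowOf h)
  flowOf-flow h = combination-flow h row row-flow

  substitute : ∀ {m} → Expr m → (Fin m → Poly g) → Poly g
  substitute (con c) σ = con (ι c)
  substitute (var i) σ = σ i
  substitute (p ⊕ q) σ = substitute p σ ⊕ substitute q σ
  substitute (p ⊛ q) σ = substitute p σ ⊛ substitute q σ
  substitute (⊝ p)   σ = con (- 1#) ⊛ substitute p σ

  eval-substitute : ∀ {m} (p : Expr m) σ h → evalP (substitute p σ) h ≈ eval p (λ i → evalP (σ i) h)
  eval-substitute (con c) σ h = refl
  eval-substitute (var i) σ h = refl
  eval-substitute (p ⊕ q) σ h = +-cong (eval-substitute p σ h) (eval-substitute q σ h)
  eval-substitute (p ⊛ q) σ h = *-cong (eval-substitute p σ h) (eval-substitute q σ h)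
  eval-substitute (⊝ p)   σ h = trans (*-congˡ (eval-substitute p σ h))
    (trans (solve 2 (λ a x → :- a :* x := :- (a :* x)) refl 1# _) (-‿cong (*-identityˡ _)))

  sumP : ∀ {m} → (Fin m → Poly g) → Poly g
  sumP {zero}  f = con 0#
  sumP {suc m} f = f zero ⊕ sumP (f ∘ suc)

  eval-sumP : ∀ {m} (f : Fin m → Poly g) h → evalP (sumP f) h ≈ sum (λ i → evalP (f i) h)
  eval-sumP {zero}  f h = refl
  eval-sumP {suc m} f h = +-congˡ (eval-sumP (f ∘ suc) h)

  τ₀ : Fin e → Carrier
  τ₀ = proj₁ genericPoint

  -- An affine section of the projection to flows, chosen to pass through the generic point τ₀.
  lift : Fin e → Poly g
  lift x = con (τ₀ x - project τ₀ x) ⊕ sumP (λ i → var i ⊛ con (row i x))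

  liftAt : (Fin g → Carrier) → Fin e → Carrier
  liftAt h x = evalP (lift x) h

  liftAt≈ : ∀ h x → liftAt h x ≈ (τ₀ x - project τ₀ x) + flowOf h x
  liftAt≈ h x = +-congˡ (eval-sumP (λ i → var i ⊛ con (row i x)) h)

  -- The constant term of the section is killed, because the projection fixes flows and is therefore
  -- idempotent.
  project-liftAt : ∀ h x → project (liftAt h) x ≈ flowOf h x
  project-liftAt h x = begin
    sum (λ j → liftAt h j * basic j x)
      ≈⟨ sum-cong-≋ (λ j → trans (*-congʳ (liftAt≈ h j))
           (solve 4 (λ a b c d → ((a :- b) :+ c) :* d := (a :* d :- b :* d) :+ c :* d) refl
              (τ₀ j) (project τ₀ j) (flowOf h j) (basic j x))) ⟩
    sum (λ j → (τ₀ j * basic j x - project τ₀ j * basic j x) + flowOf h j * basic j x)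
      ≈⟨ sum-+ (λ j → τ₀ j * basic j x - project τ₀ j * basic j x) _ ⟩
    sum (λ j → τ₀ j * basic j x - project τ₀ j * basic j x) + sum (λ j → flowOf h j * basic j x)
      ≈⟨ +-cong (sum-sub (λ j → τ₀ j * basic j x) _) (flow-expansion (flowOf-flow h) x) ⟩
    (project τ₀ x - sum (λ j → project τ₀ j * basic j x)) + flowOf h x
      ≈⟨ +-congʳ (+-congˡ (-‿cong (flow-expansion (project-flow τ₀) x))) ⟩
    (project τ₀ x - project τ₀ x) + flowOf h x
      ≈⟨ trans (+-congʳ (-‿inverseʳ _)) (+-identityˡ _) ⟩
    flowOf h x ∎

  P : Poly g
  P = substitute generic lift

  -- The coordinates of the flow of `τ₀`. There the section takes the value `τ₀`, so `P` inherits a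
  -- nonzero value from `generic`.
  h₀ : Fin g → Carrier
  h₀ = proj₁ (coordinates (project-flow τ₀))

  P-h₀ : ¬ evalP P h₀ ≈ 0#
  P-h₀ P≈0 = proj₂ genericPoint (begin
    eval generic τ₀             ≈⟨ sym (eval-cong generic (λ x → begin
      liftAt h₀ x                            ≈⟨ liftAt≈ h₀ x ⟩
      (τ₀ x - project τ₀ x) + flowOf h₀ x    ≈⟨ +-congˡ (sym (proj₂ (coordinates (project-flow τ₀)) x)) ⟩
      (τ₀ x - project τ₀ x) + project τ₀ x   ≈⟨ solve 2 (λ a b → (a :- b) :+ b := a) refl (τ₀ x) (project τ₀ x) ⟩
      τ₀ x                                   ∎)) ⟩
    eval generic (liftAt h₀)    ≈⟨ sym (eval-substitute generic lift h₀) ⟩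
    evalP P h₀                  ≈⟨ P≈0 ⟩
    0#                          ∎)

  module _ (h : Fin g → Carrier) (Ph≉0 : ¬ evalP P h ≈ 0#) where
    open Generic (liftAt h) (λ eq → Ph≉0 (trans (eval-substitute generic lift h) eq))

    t≈ : ∀ x → t x ≈ flowOf h x
    t≈ = project-liftAt h

    Rep : Fin n → (Fin g → Carrier) → Set
    Rep = RepOf G Cyc h

    point-of-t : ∀ v → point t v t ≈ 0#
    point-of-t v = trans (point≈ t v t)
      (trans (+-congˡ (-‿cong (*-comm _ _))) (-‿inverseʳ _))

    -- Hence the vector given by a form `a` lies on the hyperplane `h` exactly when `a` vanishes on
    -- the flow `t`.
    sum-h : ∀ (a : Fin e → Carrier) →
            sum (λ i → h i * sum (λ x → a x * row i x)) ≈ sum (λ x → a x * t x)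
    sum-h a = trans (sym (sum-combination a h row)) (sum-cong-≋ (λ x → *-congˡ (sym (t≈ x))))

    coord-off : ∀ v x → ¬ Inc v x → coord t v x ≈ 0#
    coord-off v x ¬inc = begin
      coord t v x
        ≈⟨ +-cong (*-congˡ (*-congˡ (δ-≢ {a = e₁ v} {x} (λ eq → ¬inc (≡.subst (Inc v) eq (inc₁ v))))))
                  (-‿cong (*-congˡ (*-congˡ (δ-≢ {a = e₂ v} {x} (λ eq → ¬inc (≡.subst (Inc v) eq (inc₂ v))))))) ⟩
      out t v (e₂ v) * (ε v (e₁ v) * 0#) - out t v (e₁ v) * (ε v (e₂ v) * 0#)
        ≈⟨ solve 4 (λ a b c d → a :* (b :* :con (+ 0)) :- c :* (d :* :con (+ 0)) := :con (+ 0)) refl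
             (out t v (e₂ v)) (ε v (e₁ v)) (out t v (e₁ v)) (ε v (e₂ v)) ⟩
      0# ∎

    pointVec : Fin n → Fin g → Carrier
    pointVec v i = point t v (row i)

    sum-flows : ∀ (c : Fin n → Carrier) → (∀ i → sum (λ v → c v * pointVec v i) ≈ 0#) →
                ∀ {s} → IsFlow s → sum (λ v → c v * point t v s) ≈ 0#
    sum-flows c rel {s} flow = begin
      sum (λ v → c v * point t v s)
        ≈⟨ sum-cong-≋ (λ v → *-congˡ (trans (point-cong t v (proj₂ (coordinates flow)))
                                            (sum-combination (coord t v) k row))) ⟩
      sum (λ v → c v * sum (λ i → k i * pointVec v i))
        ≈⟨ sum-combination c k (λ i v → pointVec v i) ⟩
      sum (λ i → k i * sum (λ v → c v * pointVec v i))
        ≈⟨ sum-zero (λ i → trans (*-congˡ (rel i)) (zeroʳ _)) ⟩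
      0# ∎
      where
      k : Fin g → Carrier
      k = proj₁ (coordinates flow)

    -- Locating the coordinate would need a zero test in `K`. The double negation is enough, since
    -- the result is used only towards a contradiction.
    pointVec-nonzero : ∀ v → ¬ ¬ ∃ λ i → ¬ pointVec v i ≈ 0#
    pointVec-nonzero v none =
      ¬¬-all (λ i p≉0 → none (i , p≉0)) λ p≈0 →
      let s , flow , s≉0 = point-nonzero v
          k , s≈ = coordinates flow
      in s≉0 (trans (point-cong t v s≈) (trans (sum-combination (coord t v) k row)
           (sum-zero (λ i → trans (*-congˡ (p≈0 i)) (zeroʳ _)))))

    pointVec-rep : ∀ v → (∃ λ i → ¬ pointVec v i ≈ 0#) → Rep v (pointVec v)
    pointVec-rep v nonzero =
      ( (λ x → coord t v x * sign x)
      , (λ x ¬inc → trans (*-congʳ (coord-off v x ¬inc)) (zeroˡ _))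
      , (λ i → trans (sum-cong-≋ (λ x → sym (*-assoc (coord t v x) (sign x) (Cyc i x))))
                     (sym (∑≈sum (λ x → (coord t v x * sign x) * Cyc i x)))))
      , nonzero
      , trans (∑≈sum (λ i → h i * pointVec v i)) (trans (sum-h (coord t v)) (point-of-t v))

    -- Makes independence insensitive to the choice of representatives. The factor is nonzero
    -- because `w` has a nonzero coordinate.
    rep-multiple : ∀ v w → Rep v w → ∃ λ μ → ¬ μ ≈ 0# × (∀ i → w i ≈ μ * pointVec v i)
    rep-multiple v w ((a , a-off , w≈) , (i₀ , w≉0) , hw≈0) = μ , μ≉0 , w≈μ
      where
      a′ : Fin e → Carrier
      a′ x = a x * sign x
      w≈′ : ∀ i → w i ≈ sum (λ x → a′ x * row i x)
      w≈′ i = trans (w≈ i) (trans (∑≈sum (λ x → a x * Cyc i x)) (sum-cong-≋ (λ x → begin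
        a x * Cyc i x
          ≈⟨ *-congˡ (sym (signed-signed (Cyc i) x)) ⟩
        a x * (sign x * row i x)
          ≈⟨ sym (*-assoc _ _ _) ⟩
        a′ x * row i x ∎)))
      at≈0 : sum (λ x → a′ x * t x) ≈ 0#
      at≈0 = begin
        sum (λ x → a′ x * t x)                          ≈⟨ sym (sum-h a′) ⟩
        sum (λ i → h i * sum (λ x → a′ x * row i x))    ≈⟨ sum-cong-≋ (λ i → *-congˡ (sym (w≈′ i))) ⟩
        sum (λ i → h i * w i)                           ≈⟨ sym (∑≈sum (λ i → h i * w i)) ⟩
        ∑ (λ i → h i * w i)                             ≈⟨ hw≈0 ⟩
        0#                                              ∎
      unique : ∃ λ μ → ∀ s → IsFlow s → sum (λ x → a′ x * s x) ≈ μ * point t v s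
      unique = point-unique v a′ (λ x ¬inc → trans (*-congʳ (a-off x ¬inc)) (zeroˡ _)) at≈0
      μ : Carrier
      μ = proj₁ unique
      w≈μ : ∀ i → w i ≈ μ * pointVec v i
      w≈μ i = trans (w≈′ i) (proj₂ unique (row i) (row-flow i))
      μ≉0 : ¬ μ ≈ 0#
      μ≉0 μ≈0 = w≉0 (trans (w≈μ i₀) (trans (*-congʳ μ≈0) (zeroˡ _)))

    mask : Subset n → (Fin n → Carrier) → Fin n → Carrier
    mask S c v = if lookup S v then c v else 0#

    mask-in : ∀ {S v} c → v ∈ S → mask S c v ≈ c v
    mask-in {S} {v} c v∈S = reflexive (≡.cong (λ b → if b then c v else 0#) ([]=⇒lookup v∈S))

    mask-out : ∀ {S v} c → v ∉ S → mask S c v ≈ 0#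
    mask-out {S} {v} c v∉S with lookup S v in eq
    ... | true  = contradiction (lookup⇒[]= v S eq) v∉S
    ... | false = refl

    mask-supported : ∀ {S} c → (∀ v → v ∉ S → c v ≈ 0#) → ∀ v → mask S c v ≈ c v
    mask-supported {S} c off v with v ∈? S
    ... | yes v∈S = mask-in {S} c v∈S
    ... | no v∉S  = trans (mask-out {S} c v∉S) (sym (off v v∉S))

    -- `M S` is Boolean, so an argument by contradiction is available: a dependency of the forms
    -- would be one of the representatives `pointVec`.
    indep⇒M : ∀ S → Indep G Cyc h S → M S ≡ true
    indep⇒M S indep with M S Boolₚ.≟ true
    ... | yes MS = MS
    ... | no ¬MS = ⊥-elim (¬¬-all pointVec-nonzero λ nonzero →
            pivot≉0 (indep pointVec (λ v _ → pointVec-rep v (nonzero v)) coeff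
              (λ i → trans (∑≈sum (λ v → mask S coeff v * pointVec v i))
                (trans (sum-cong-≋ (λ v → *-congʳ (mask-supported {S} coeff support v)))
                       (relation-flow t coeff relation (row-flow i))))
              pivot pivot∈S))
      where
      open Generic.DependentAt (dependent {S} ¬MS)
      pivot∈S : pivot ∈ S
      pivot∈S with pivot ∈? S
      ... | yes p∈S = p∈S
      ... | no p∉S  = contradiction (support pivot p∉S) pivot≉0

    M⇒indep : ∀ S → M S ≡ true → Indep G Cyc h S
    M⇒indep S MS w rep c rel v v∈S = proj₂ (proj₂ (proj₂ (scaled v))) v∈S
      (independent {S} MS C (λ u → proj₁ (proj₂ (scaled u))) (λ j → sum-flows C C-rel (basic-flow j)) v)
      where
      -- Representatives are given only for vertices in `S`; elsewhere the masked coefficient is 0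
      -- and no scaling factor is required.
      scaled : ∀ u → ∃ λ C → (u ∉ S → C ≈ 0#)
                           × (∀ i → mask S c u * w u i ≈ C * pointVec u i)
                           × (u ∈ S → C ≈ 0# → c u ≈ 0#)
      scaled u with u ∈? S
      ... | no u∉S = 0# , (λ _ → refl)
                   , (λ i → trans (trans (*-congʳ (mask-out {S} c u∉S)) (zeroˡ _)) (sym (zeroˡ _)))
                   , λ u∈S → contradiction u∈S u∉S
      ... | yes u∈S =
        let μ , μ≉0 , w≈ = rep-multiple u (w u) (rep u u∈S) in
          μ * c u
        , (λ u∉S → contradiction u∈S u∉S)
        , (λ i → trans (*-cong (mask-in {S} c u∈S) (w≈ i))
                   (solve 3 (λ c m p → c :* (m :* p) := (m :* c) :* p) refl (c u) μ (pointVec u i)))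
        , λ _ → cancel-≉0 μ≉0
      C : Fin n → Carrier
      C u = proj₁ (scaled u)
      C-rel : ∀ i → sum (λ u → C u * pointVec u i) ≈ 0#
      C-rel i = begin
        sum (λ u → C u * pointVec u i)        ≈⟨ sum-cong-≋ (λ u → sym (proj₁ (proj₂ (proj₂ (scaled u))) i)) ⟩
        sum (λ u → mask S c u * w u i)        ≈⟨ sym (∑≈sum (λ u → mask S c u * w u i)) ⟩
        ∑ (λ u → mask S c u * w u i)          ≈⟨ rel i ⟩
        0#                                    ∎

open import Data.Nat using (_*_)

theorem5p5 : (K : ACField) → (g : ℕ) → 3 ≤ g →
    (G : Graph (2 * g ∸ 2) (3 * g ∸ 3)) → Trivalent G → ThreeConnected G →
    ∃ λ (M : Subset (2 * g ∸ 2) → Bool) →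
    SelfDual M (g ∸ 1)
    × (∀ (o : Lin.Orientation K G) (Cyc : Fin g → Fin (3 * g ∸ 3) → ACField.Carrier K) →
    Lin.CycMatrix K G g o Cyc →
    ∃ λ (P : Lin.Poly K g) →
    (∃ λ (h₀ : Fin g → ACField.Carrier K) →
    ¬ ACField._≈_ K (Lin.evalP K P h₀) (ACField.0# K))
    × (∀ (h : Fin g → ACField.Carrier K) →
    ¬ ACField._≈_ K (Lin.evalP K P h) (ACField.0# K) →
    ∀ (S : Subset (2 * g ∸ 2)) → Lin.Indep K G Cyc h S ⇔ (M S ≡ true)))
theorem5p5 K g _ G trivalent connected =
  M , selfDual (g ∸ 1) 2g∸2 , λ o Cyc cyc →
    let open Realization K G trivalent connected o Cyc cyc in
    P , (h₀ , P-h₀) , λ h Ph≉0 S → mk⇔ (indep⇒M h Ph≉0 S) (M⇒indep h Ph≉0 S)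
  where
  open GraphMatroid K G trivalent connected using (M; selfDual)
  2g∸2 : 2 * g ∸ 2 ≡ (g ∸ 1) ℕ.+ (g ∸ 1)
  2g∸2 = ≡.trans (≡.sym (ℕₚ.*-distribˡ-∸ 2 g 1)) (≡.cong ((g ∸ 1) ℕ.+_) (ℕₚ.+-identityʳ (g ∸ 1)))
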